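{- There is no $(d,D,-2)$-graph with $d\ge 4$ even and $D\ge 4$.
   Context: All graphs are simple. For integers $\Delta\ge 2$, $D\ge 1$, the Moore bound is $M(\Delta,D)=1+\Delta\left(1+(\Delta-1)+\dots+(\Delta-1)^{D-1}\right)$. For $\epsilon\ge 0$, a $(\Delta,D,-\epsilon)$-graph is a graph of maximum degree $\Delta$, diameter $D$, and order exactly $M(\Delta,D)-\epsilon$. -}

module Defs where

open import Data.Nat using (ℕ; zero; suc; _+_; _*_; _∸_; _^_; _≤_)
open import Data.Bool using (Bool; true; false)
open import Data.Fin using (Fin)
open import Data.List using (List; length; filter; allFin)
open import Data.Product using (Σ; ∃; _×_; _,_)
open import Relation.Binary.PropositionalEquality using (_≡_)
open import Relation.Nullary using (¬_)
open import Data.Bool.Properties using (T?)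
open import Data.Bool using (T)

record SimpleGraph (n : ℕ) : Set where
  field
    adj     : Fin n → Fin n → Bool
    symm    : ∀ u v → adj u v ≡ adj v u
    irrefl  : ∀ v → adj v v ≡ false

open SimpleGraph public

degree : ∀ {n} → SimpleGraph n → Fin n → ℕ
degree {n} G v = length (filter (λ u → T? (adj G v u)) (allFin n))

MaxDegree : ∀ {n} → SimpleGraph n → ℕ → Set
MaxDegree {n} G Δ = (∀ v → degree G v ≤ Δ) × (∃ λ v → degree G v ≡ Δ)

data Walk {n : ℕ} (G : SimpleGraph n) : ℕ → Fin n → Fin n → Set where
  here : ∀ {u} → Walk G zero u u
  step : ∀ {k u w v} → T (adj G u w) → Walk G k w v → Walk G (suc k) u v

DistLe : ∀ {n} → SimpleGraph n → Fin n → Fin n → ℕ → Set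
DistLe G u v k = ∃ λ j → j ≤ k × Walk G j u v

Diameter : ∀ {n} → SimpleGraph n → ℕ → Set
Diameter G D =
  (∀ u v → DistLe G u v D) ×
  (∃ λ u → ∃ λ v → ∀ j → Walk G j u v → D ≤ j)

geomSum : ℕ → ℕ → ℕ
geomSum q zero    = 0
geomSum q (suc k) = geomSum q k + q ^ k

moore : ℕ → ℕ → ℕ
moore Δ D = 1 + Δ * geomSum (Δ ∸ 1) D

record DDEGraph (Δ D ε : ℕ) : Set where
  field
    order     : ℕ
    graph     : SimpleGraph order
    maxDeg    : MaxDegree graph Δ
    diam      : Diameter graph D
    orderEq   : order + ε ≡ moore Δ D

{-# OPTIONS --safe #-}

-- Call y a repeat of x if at least two non-backtracking walks of length at most D lead from x to y.
-- Counting walks shows that the graph is d-regular, that every vertex has exactly two repeats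
-- r₁ x, r₂ x (possibly equal), and that the girth is at least 2D - 1. The matrix of repeats is a
-- polynomial in the adjacency matrix A minus the all-ones matrix, so it is symmetric and commutes
-- with A, which reads A z (r₁ x) + A z (r₂ x) = A x (r₁ z) + A x (r₂ z).
--
-- Two repeats are antipodal on a cycle k of length 2D, unless they lie on a cycle of length 2D - 1.
-- Replacing each vertex of k by the other repeat of its antipode gives another 2D-cycle, and then the
-- repeat relation closes up into 4-cycles along k, unless k is crossed somewhere: for some edge of k,
-- each end is adjacent to the vertex replacing the other end. Given a crossing or a (2D - 1)-cycle,
-- there are vertices u₀, u₂ at distance at most 2 with a common repeat. A neighbour w of u₀ away
-- from these cycles has a repeat with another repeat w₂ adjacent to u₂, and the repeats of w do not
-- close up into a 4-cycle. So a 2D-cycle through w is crossed too, and the path from w to w₂ through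
-- that crossing closes with the one through u₀ and u₂ to a cycle of length at most 2D, which either
-- violates the girth or exceeds the number of repeats of a vertex on it.
--
-- Hence the repeat relation consists of double edges and 4-cycles, which yields a fixed-point-free
-- involution on the vertices. But for even d the order M(d,D) - 2 is odd.

module Submission where

open import Defs
open import Data.Bool using (true; false; if_then_else_; T)
open import Data.Bool.Properties using (T?)
open import Data.Empty using (⊥; ⊥-elim)
open import Data.Fin using (Fin; zero; suc)
import Data.Fin.Properties as Fin
open import Data.List using (List; []; _∷_; map; length; filter; tabulate)
open import Data.List.Membership.Propositional using (_∉_)
open import Data.List.Relation.Unary.Any using (here; there)
open import Data.Nat
open import Data.Nat.Divisibility using (_∣_; divides)
open import Data.Nat.DivMod using (_%_; m%n<n; %-distribˡ-+; [m+n]%n≡m%n; m<n⇒m%n≡m; n%n≡0)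
open import Data.Nat.ListAction using () renaming (sum to sumL)
open import Data.Nat.Properties
open import Data.Nat.Solver using (module +-*-Solver)
open import Data.Product using (∃; ∃₂; _×_; _,_; proj₁; proj₂)
open import Data.Sum using (_⊎_; inj₁; inj₂; [_,_]′)
open import Data.Unit using (tt)
open import Function using (_∘_)
open import Relation.Binary.PropositionalEquality
open import Relation.Nullary
open import Relation.Nullary.Decidable using (_×-dec_)
open import Relation.Unary using (Decidable)
open import Algebra.Properties.Semiring.Sum +-*-semiring
  using (sum; ∑-distrib-+; ∑-comm; sum-cong-≗; *-distribˡ-sum; sum-replicate-zero)

private variable n : ℕ

-- Kronecker deltas, finite sums and parity.

δ ne : Fin n → Fin n → ℕ
δ x y = if does (x Fin.≟ y) then 1 else 0
ne x y = if does (x Fin.≟ y) then 0 else 1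

δ-refl : (x : Fin n) → δ x x ≡ 1
δ-refl x with x Fin.≟ x
... | yes _ = refl
... | no x≢x = ⊥-elim (x≢x refl)

δ-≢ : {x y : Fin n} → x ≢ y → δ x y ≡ 0
δ-≢ {x = x} {y} x≢y with x Fin.≟ y
... | yes x≡y = ⊥-elim (x≢y x≡y)
... | no _ = refl

δ-pos : {x y : Fin n} → 1 ≤ δ x y → x ≡ y
δ-pos {x = x} {y} 1≤δ with x Fin.≟ y
... | yes x≡y = x≡y

δ-sym : (x y : Fin n) → δ x y ≡ δ y x
δ-sym x y with x Fin.≟ y
... | yes refl = sym (δ-refl x)
... | no x≢y = sym (δ-≢ (x≢y ∘ sym))

ne-refl : (x : Fin n) → ne x x ≡ 0
ne-refl x with x Fin.≟ x
... | yes _ = refl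
... | no x≢x = ⊥-elim (x≢x refl)

ne-≢ : {x y : Fin n} → x ≢ y → ne x y ≡ 1
ne-≢ {x = x} {y} x≢y with x Fin.≟ y
... | yes x≡y = ⊥-elim (x≢y x≡y)
... | no _ = refl

ne-pos : {x y : Fin n} → 1 ≤ ne x y → x ≢ y
ne-pos {x = x} {y} 1≤ne with x Fin.≟ y
... | no x≢y = x≢y

ne-sym : (x y : Fin n) → ne x y ≡ ne y x
ne-sym x y with x Fin.≟ y
... | yes refl = sym (ne-refl x)
... | no x≢y = sym (ne-≢ (x≢y ∘ sym))

ne+δ : (x y : Fin n) → ne x y + δ x y ≡ 1
ne+δ x y with x Fin.≟ y
... | yes _ = refl
... | no _ = refl

sum-zero : (f : Fin n → ℕ) → (∀ i → f i ≡ 0) → sum f ≡ 0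
sum-zero {n} f f≡0 = trans (sum-cong-≗ f≡0) (sum-replicate-zero n)

sum-one : ∀ n → sum {n} (λ _ → 1) ≡ n
sum-one zero = refl
sum-one (suc n) = cong suc (sum-one n)

sum-δ : (x : Fin n) (f : Fin n → ℕ) → sum (λ y → δ x y * f y) ≡ f x
sum-δ zero f = begin
  f zero + 0 + sum (λ y → 0 * f (suc y))  ≡⟨ cong₂ _+_ (+-identityʳ _)
      (sum-zero (λ y → 0 * f (suc y)) (λ _ → refl)) ⟩
  f zero + 0                              ≡⟨ +-identityʳ _ ⟩
  f zero                                  ∎
  where open ≡-Reasoning
sum-δ (suc x) f = sum-δ x (f ∘ suc)

sum-mono : {f g : Fin n → ℕ} → (∀ i → f i ≤ g i) → sum f ≤ sum g
sum-mono {zero} f≤g = z≤n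
sum-mono {suc n} f≤g = +-mono-≤ (f≤g zero) (sum-mono (f≤g ∘ suc))

sum-split : (x : Fin n) (f : Fin n → ℕ) → sum f ≡ f x + sum (λ y → ne x y * f y)
sum-split x f = begin
  sum f                                                  ≡⟨ sum-cong-≗ split ⟩
  sum (λ y → δ x y * f y + ne x y * f y)                 ≡⟨ ∑-distrib-+ _ (λ y → ne x y * f y) ⟩
  sum (λ y → δ x y * f y) + sum (λ y → ne x y * f y)     ≡⟨ cong (_+ sum (λ y → ne x y * f y)) (sum-δ x f) ⟩
  f x + sum (λ y → ne x y * f y)                         ∎
  where
  open ≡-Reasoning
  split : ∀ y → f y ≡ δ x y * f y + ne x y * f y
  split y = begin
    f y                            ≡⟨ sym (*-identityˡ _) ⟩
    1 * f y                        ≡⟨ cong (_* f y) (trans (sym (ne+δ x y)) (+-comm (ne x y) _)) ⟩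
    (δ x y + ne x y) * f y         ≡⟨ *-distribʳ-+ (f y) (δ x y) (ne x y) ⟩
    δ x y * f y + ne x y * f y     ∎

sum-pos : (f : Fin n → ℕ) → 1 ≤ sum f → ∃ λ x → 1 ≤ f x
sum-pos {suc n} f 1≤Σ with f zero in eq
... | suc _ = zero , subst (1 ≤_) (sym eq) (s≤s z≤n)
... | zero with sum-pos (f ∘ suc) 1≤Σ
... | x , 1≤fx = suc x , 1≤fx

*-pos : ∀ a {b} → 1 ≤ a * b → 1 ≤ a × 1 ≤ b
*-pos (suc a) {suc b} _ = s≤s z≤n , s≤s z≤n
*-pos (suc a) {zero} 1≤ = ⊥-elim (<⇒≱ 1≤ (≤-reflexive (*-zeroʳ a)))

sumL-mono : ∀ {A : Set} (f g : A → ℕ) xs → (∀ x → f x ≤ g x) → sumL (map f xs) ≤ sumL (map g xs)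
sumL-mono f g [] f≤g = z≤n
sumL-mono f g (x ∷ xs) f≤g = +-mono-≤ (f≤g x) (sumL-mono f g xs f≤g)

ne-*-≤ : (x : Fin n) (f : Fin n → ℕ) → ∀ y → ne x y * f y ≤ f y
ne-*-≤ x f y with x Fin.≟ y
... | yes _ = z≤n
... | no _ = ≤-reflexive (+-identityʳ _)

-- Masking `f` by `ne a` lowers the full sum by exactly `f a` and does not raise the sum over the
-- rest of the list, so the strict inequality survives the removal of the head.
sum-pick : (xs : List (Fin n)) (f : Fin n → ℕ) → sumL (map f xs) < sum f →
           ∃ λ x → x ∉ xs × 1 ≤ f x
sum-pick [] f 0<Σ with sum-pos f 0<Σ
... | x , 1≤fx = x , (λ ()) , 1≤fx
sum-pick (a ∷ as) f lt with sum-pick as (λ y → ne a y * f y) lt′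
  where
  lt′ : sumL (map (λ y → ne a y * f y) as) < sum (λ y → ne a y * f y)
  lt′ = ≤-<-trans (sumL-mono _ f as (ne-*-≤ a f))
          (+-cancelˡ-< (f a) _ _ (subst (f a + sumL (map f as) <_) (sum-split a f) lt))
... | x , x∉as , 1≤ with *-pos (ne a x) 1≤
... | 1≤ne , 1≤fx = x , (λ { (here refl) → ne-pos {x = a} 1≤ne refl ; (there x∈as) → x∉as x∈as }) , 1≤fx

sum-≥1 : (f : Fin n → ℕ) (x : Fin n) → f x ≤ sum f
sum-≥1 f x = subst (f x ≤_) (sym (sum-split x f)) (m≤m+n _ _)

sum-≥2 : (f : Fin n → ℕ) {x y : Fin n} → x ≢ y → f x + f y ≤ sum f
sum-≥2 f {x} {y} x≢y = subst (f x + f y ≤_) (sym (sum-split x f)) (+-monoʳ-≤ (f x)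
  (≤-trans (≤-reflexive (sym (trans (cong (_* f y) (ne-≢ x≢y)) (*-identityˡ _)))) (sum-≥1 _ y)))

sum-≥3 : (f : Fin n → ℕ) {x y z : Fin n} → x ≢ y → x ≢ z → y ≢ z → f x + (f y + f z) ≤ sum f
sum-≥3 f {x} {y} {z} x≢y x≢z y≢z = subst (f x + (f y + f z) ≤_) (sym (sum-split x f)) (+-monoʳ-≤ (f x)
  (≤-trans (≤-reflexive (sym (cong₂ _+_ (lem x≢y) (lem x≢z)))) (sum-≥2 _ y≢z)))
  where
  lem : ∀ {v} → x ≢ v → ne x v * f v ≡ f v
  lem x≢v = trans (cong (_* f _) (ne-≢ x≢v)) (*-identityˡ _)

-- One unit is taken from any point where `f` is positive. Done twice to a function of sum two, this
-- yields the two repeats of a vertex, equal or not.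
sum-unit : ∀ {m} (f : Fin n → ℕ) → sum f ≡ suc m →
           ∃ λ x → ∃ λ g → (∀ y → f y ≡ δ y x + g y) × sum g ≡ m
sum-unit {m = m} f Σf with sum-pos f (≤-trans (s≤s z≤n) (≤-reflexive (sym Σf)))
... | x , 1≤fx = x , g , f≡ , suc-injective (trans (sym Σ≡) Σf)
  where
  open ≡-Reasoning
  g : _ → ℕ
  g y = f y ∸ δ y x
  δ≤f : ∀ y → δ y x ≤ f y
  δ≤f y with y Fin.≟ x
  ... | yes refl = 1≤fx
  ... | no _ = z≤n
  f≡ : ∀ y → f y ≡ δ y x + g y
  f≡ y = sym (m+[n∸m]≡n (δ≤f y))
  Σ≡ : sum f ≡ suc (sum g)
  Σ≡ = begin
    sum f                                ≡⟨ sum-cong-≗ f≡ ⟩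
    sum (λ y → δ y x + g y)              ≡⟨ ∑-distrib-+ _ g ⟩
    sum (λ y → δ y x) + sum g            ≡⟨ cong (_+ sum g)
        (sum-cong-≗ (λ y → trans (δ-sym y x) (sym (*-identityʳ _)))) ⟩
    sum (λ y → δ x y * 1) + sum g        ≡⟨ cong (_+ sum g) (sum-δ x (λ _ → 1)) ⟩
    suc (sum g)                          ∎

sum-≡0 : (f : Fin n → ℕ) → sum f ≡ 0 → ∀ x → f x ≡ 0
sum-≡0 f Σ≡0 x = n≤0⇒n≡0 (subst (f x ≤_) Σ≡0 (sum-≥1 f x))

-- Deleting the first row and column of such a matrix removes twice the first row.
sum-sym-even : (M : Fin n → Fin n → ℕ) → (∀ x → M x x ≡ 0) → (∀ x y → M x y ≡ M y x) →
               ∃ λ h → sum (λ x → sum (M x)) ≡ h + h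
sum-sym-even {zero} M diag M-sym = 0 , refl
sum-sym-even {suc n} M diag M-sym
  with sum-sym-even (λ x y → M (suc x) (suc y)) (diag ∘ suc) (λ x y → M-sym (suc x) (suc y))
... | h , Σ≡ = r + h , eq
  where
  open ≡-Reasoning
  r = sum (λ y → M zero (suc y))
  eq : M zero zero + r + sum (λ x → sum (M (suc x))) ≡ (r + h) + (r + h)
  eq = begin
    M zero zero + r + sum (λ x → M (suc x) zero + sum (λ y → M (suc x) (suc y)))
      ≡⟨ cong₂ (λ a b → a + r + b) (diag zero) (∑-distrib-+ (λ x → M (suc x) zero)
          (λ x → sum (λ y → M (suc x) (suc y)))) ⟩
    r + (sum (λ x → M (suc x) zero) + sum (λ x → sum (λ y → M (suc x) (suc y))))
      ≡⟨ cong₂ (λ a b → r + (a + b)) (sum-cong-≗ (λ x → M-sym (suc x) zero)) Σ≡ ⟩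
    r + (r + (h + h))   ≡⟨ +-assoc r r _ ⟨
    r + r + (h + h)     ≡⟨ +-assoc (r + r) h h ⟨
    r + r + h + h       ≡⟨ cong (_+ h) (+-assoc r r h) ⟩
    r + (r + h) + h     ≡⟨ cong (_+ h) (+-comm r _) ⟩
    r + h + r + h       ≡⟨ +-assoc (r + h) r h ⟩
    (r + h) + (r + h)   ∎

-- The permutation matrix of `τ` is symmetric with zero diagonal, and its entries add up to `n`.
involution-even : (τ : Fin n → Fin n) → (∀ x → τ x ≢ x) → (∀ x → τ (τ x) ≡ x) → ∃ λ h → n ≡ h + h
involution-even {n} τ τ≢ ττ with sum-sym-even (λ x y → δ (τ x) y) (λ x → δ-≢ (τ≢ x)) M-sym
  where
  M-sym : ∀ x y → δ (τ x) y ≡ δ (τ y) x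
  M-sym x y with τ x Fin.≟ y
  ... | yes refl = sym (trans (cong (λ z → δ z x) (ττ x)) (δ-refl x))
  ... | no τx≢y = sym (δ-≢ (λ τy≡x → τx≢y (trans (cong τ (sym τy≡x)) (ττ y))))
... | h , Σ≡ = h , trans (sym rows) Σ≡
  where
  rows : sum (λ x → sum (δ (τ x))) ≡ n
  rows = trans (sum-cong-≗ (λ x → trans (sum-cong-≗ (λ y → sym (*-identityʳ (δ (τ x) y))))
      (sum-δ (τ x) (λ _ → 1)))) (sum-one n)

double≢odd : ∀ m n → m + m ≢ suc (n + n)
double≢odd zero n ()
double≢odd (suc m) zero e with trans (sym (+-suc m m)) (suc-injective e)
... | ()
double≢odd (suc m) (suc n) e = double≢odd m n
  (suc-injective (suc-injective (trans (cong suc (sym (+-suc m m)))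
      (trans e (cong (λ t → suc (suc t)) (+-suc n n))))))

least : {P : ℕ → Set} → Decidable P → ∀ b → P b → ∃ λ i → i ≤ b × P i × (∀ j → j < i → ¬ P j)
least {P} P? b Pb = search b 0 (+-identityʳ b) (λ _ ())
  where
  search : ∀ r i → r + i ≡ b → (∀ j → j < i → ¬ P j) → ∃ λ i → i ≤ b × P i × (∀ j → j < i → ¬ P j)
  search r i eq none with P? i
  ... | yes Pi = i , subst (i ≤_) eq (m≤n+m i r) , Pi , none
  search zero i refl none | no ¬Pi = ⊥-elim (¬Pi Pb)
  search (suc r) i eq none | no ¬Pi = search r (suc i) (trans (+-suc r i) eq)
    (λ j j< → [ none j , (λ { refl → ¬Pi }) ]′ (m≤n⇒m<n∨m≡n (s≤s⁻¹ j<)))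

-- The adjacency matrix.

module Graph {n : ℕ} (G : SimpleGraph n) where

  V : Set
  V = Fin n

  infix 4 _~_ _≁_
  _~_ _≁_ : V → V → Set
  x ~ y = T (adj G x y)
  x ≁ y = ¬ x ~ y

  A : V → V → ℕ
  A x y = if adj G x y then 1 else 0

  ~-sym : ∀ {x y} → x ~ y → y ~ x
  ~-sym {x} {y} = subst T (symm G x y)

  ~-irrefl : ∀ {x} → x ≁ x
  ~-irrefl {x} = subst T (irrefl G x)

  ~⇒≢ : ∀ {x y} → x ~ y → x ≢ y
  ~⇒≢ x~y refl = ~-irrefl x~y

  A-sym : ∀ x y → A x y ≡ A y x
  A-sym x y = cong (if_then 1 else 0) (symm G x y)

  ~⇒A≡1 : ∀ {x y} → x ~ y → A x y ≡ 1
  ~⇒A≡1 {x} {y} x~y with adj G x y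
  ... | true = refl

  ≁⇒A≡0 : ∀ {x y} → x ≁ y → A x y ≡ 0
  ≁⇒A≡0 {x} {y} x≁y with adj G x y
  ... | true = ⊥-elim (x≁y tt)
  ... | false = refl

  A-pos : ∀ {x y} → 1 ≤ A x y → x ~ y
  A-pos {x} {y} 1≤A with adj G x y
  ... | true = tt

  A-≤1 : ∀ x y → A x y ≤ 1
  A-≤1 x y with adj G x y
  ... | true = ≤-refl
  ... | false = z≤n

  A-idem : ∀ x y → A x y * A x y ≡ A x y
  A-idem x y with adj G x y
  ... | true = refl
  ... | false = refl

  degree≡ΣA : ∀ v → degree G v ≡ sum (A v)
  degree≡ΣA v = count (λ u → u)
    where
    count : ∀ {m} (f : Fin m → V) →
            length (filter (λ u → T? (adj G v u)) (tabulate f)) ≡ sum (A v ∘ f)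
    count {zero} f = refl
    count {suc m} f with adj G v (f zero)
    ... | true = cong suc (count (f ∘ suc))
    ... | false = count (f ∘ suc)

  -- Counting non-backtracking walks.

  -- P k p x z counts the non-backtracking walks of length k from x to z that do not start with a
  -- step to p; Q m p x z counts those of length < m.
  P Q : ℕ → V → V → V → ℕ
  P zero p x z = δ x z
  P (suc k) p x z = sum (λ y → A x y * (ne p y * P k x y z))
  Q zero p x z = 0
  Q (suc m) p x z = Q m p x z + P m p x z

  -- The counts without a forbidden first step: `N k` for length exactly `k`, `C m` for length at
  -- most `m`.
  N C : ℕ → V → V → ℕ
  N zero x z = δ x z
  N (suc k) x z = sum (λ y → A x y * P k x y z)
  C zero = N zero
  C (suc m) x z = C m x z + N (suc m) x z

  -- A walk is empty or has a first step `y`, after which it must not return to `x`. This permits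
  -- induction along first steps, whereas `Q` is defined by adding the longest walks.
  Q-rec : ∀ m p x z → Q (suc m) p x z ≡ δ x z + sum (λ y → A x y * (ne p y * Q m x y z))
  Q-rec zero p x z = sym (trans (cong (δ x z +_)
      (sum-zero _ (λ y → trans (cong (A x y *_) (*-zeroʳ (ne p y))) (*-zeroʳ (A x y))))) (+-identityʳ _))
  Q-rec (suc m) p x z = begin
    Q (suc m) p x z + P (suc m) p x z
      ≡⟨ cong (_+ P (suc m) p x z) (Q-rec m p x z) ⟩
    δ x z + sum (λ y → A x y * (ne p y * Q m x y z)) + sum (λ y → A x y * (ne p y * P m x y z))
      ≡⟨ +-assoc (δ x z) _ _ ⟩
    δ x z + (sum (λ y → A x y * (ne p y * Q m x y z)) + sum (λ y → A x y * (ne p y * P m x y z)))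
      ≡⟨ cong (δ x z +_) (sym (∑-distrib-+ (λ y → A x y * (ne p y * Q m x y z))
          (λ y → A x y * (ne p y * P m x y z)))) ⟩
    δ x z + sum (λ y → A x y * (ne p y * Q m x y z) + A x y * (ne p y * P m x y z))
      ≡⟨ cong (δ x z +_) (sum-cong-≗ (λ y → solve 4 (λ a b c d → a :* (b :* c) :+ a :* (b :* d) := a :*
          (b :* (c :+ d))) refl (A x y) (ne p y) (Q m x y z) (P m x y z))) ⟩
    δ x z + sum (λ y → A x y * (ne p y * Q (suc m) x y z)) ∎
    where
    open ≡-Reasoning
    open +-*-Solver

  C-rec : ∀ m x z → C m x z ≡ δ x z + sum (λ y → A x y * Q m x y z)
  C-rec zero x z = sym (trans (cong (δ x z +_) (sum-zero _ (λ y → *-zeroʳ (A x y)))) (+-identityʳ _))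
  C-rec (suc m) x z = begin
    C m x z + N (suc m) x z
      ≡⟨ cong (_+ N (suc m) x z) (C-rec m x z) ⟩
    δ x z + sum (λ y → A x y * Q m x y z) + sum (λ y → A x y * P m x y z)
      ≡⟨ +-assoc (δ x z) _ _ ⟩
    δ x z + (sum (λ y → A x y * Q m x y z) + sum (λ y → A x y * P m x y z))
      ≡⟨ cong (δ x z +_) (sym (∑-distrib-+ (λ y → A x y * Q m x y z) (λ y → A x y * P m x y z))) ⟩
    δ x z + sum (λ y → A x y * Q m x y z + A x y * P m x y z)
      ≡⟨ cong (δ x z +_) (sum-cong-≗ (λ y → sym (*-distribˡ-+ (A x y) (Q m x y z) (P m x y z)))) ⟩
    δ x z + sum (λ y → A x y * Q (suc m) x y z) ∎
    where open ≡-Reasoning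

  sum-swap-A : ∀ x (h : V → V → ℕ) →
    sum (λ z → sum (λ y → A x y * h y z)) ≡ sum (λ y → A x y * sum (h y))
  sum-swap-A x h = trans (∑-comm (λ z y → A x y * h y z))
      (sum-cong-≗ (λ y → sym (*-distribˡ-sum (A x y) (h y))))

  rowδ : ∀ x → sum {n} (δ x) ≡ 1
  rowδ x = trans (sum-cong-≗ (λ y → sym (*-identityʳ (δ x y)))) (sum-δ x (λ _ → 1))

  ΣA-ne : ∀ {p x} → p ~ x → suc (sum (λ y → A x y * ne p y)) ≡ sum (A x)
  ΣA-ne {p} {x} p~x = sym (trans (sum-split p (A x))
      (cong₂ _+_ (~⇒A≡1 (~-sym p~x)) (sum-cong-≗ (λ y → *-comm (ne p y) (A x y)))))

  rowP-rec : ∀ k p x → sum (P (suc k) p x) ≡ sum (λ y → A x y * (ne p y * sum (P k x y)))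
  rowP-rec k p x = trans (sum-swap-A x (λ y z → ne p y * P k x y z))
    (sum-cong-≗ (λ y → cong (A x y *_) (sym (*-distribˡ-sum (ne p y) (P k x y)))))

  A-*-mono : ∀ x y {a b : ℕ} → (x ~ y → a ≤ b) → A x y * a ≤ A x y * b
  A-*-mono x y f with adj G x y
  ... | true = +-monoˡ-≤ 0 (f tt)
  ... | false = z≤n

  A-*-cong : ∀ x y {a b : ℕ} → (x ~ y → a ≡ b) → A x y * a ≡ A x y * b
  A-*-cong x y f with adj G x y
  ... | true = cong (_+ 0) (f tt)
  ... | false = refl

  Σ*const : (f : V → ℕ) (c : ℕ) → sum (λ y → f y * c) ≡ sum f * c
  Σ*const f c = trans (sum-cong-≗ (λ y → *-comm (f y) c)) (trans (sym (*-distribˡ-sum c f)) (*-comm c _))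

  rowN-rec : ∀ k x → sum (N (suc k) x) ≡ sum (λ y → A x y * sum (P k x y))
  rowN-rec k x = sum-swap-A x (λ y z → P k x y z)

  module _ {q : ℕ} (deg≤ : ∀ x → sum (A x) ≤ suc q) where

    rowP-≤ : ∀ k {p x} → p ~ x → sum (P k p x) ≤ q ^ k
    rowP-≤ zero {p} {x} p~x = ≤-reflexive (rowδ x)
    rowP-≤ (suc k) {p} {x} p~x = begin
      sum (P (suc k) p x)                             ≡⟨ rowP-rec k p x ⟩
      sum (λ y → A x y * (ne p y * sum (P k x y)))    ≤⟨ sum-mono
          (λ y → A-*-mono x y (λ x~y → *-monoʳ-≤ (ne p y) (rowP-≤ k x~y))) ⟩
      sum (λ y → A x y * (ne p y * q ^ k))            ≡⟨ sum-cong-≗ (λ y → sym (*-assoc (A x y) (ne p y) _)) ⟩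
      sum (λ y → A x y * ne p y * q ^ k)              ≡⟨ Σ*const (λ y → A x y * ne p y) (q ^ k) ⟩
      sum (λ y → A x y * ne p y) * q ^ k              ≤⟨ *-monoˡ-≤ (q ^ k)
          (s≤s⁻¹ (≤-trans (≤-reflexive (ΣA-ne p~x)) (deg≤ x))) ⟩
      q * q ^ k                                       ∎
      where open ≤-Reasoning

    rowN-≤ : ∀ k x → sum (N (suc k) x) ≤ sum (A x) * q ^ k
    rowN-≤ k x = begin
      sum (N (suc k) x)                   ≡⟨ rowN-rec k x ⟩
      sum (λ y → A x y * sum (P k x y))   ≤⟨ sum-mono (λ y → A-*-mono x y (rowP-≤ k)) ⟩
      sum (λ y → A x y * q ^ k)           ≡⟨ Σ*const (A x) (q ^ k) ⟩
      sum (A x) * q ^ k                   ∎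
      where open ≤-Reasoning

    -- The degree of `x` is kept as a factor and not replaced by `suc q`, because regularity is
    -- deduced by comparing this bound with the order.
    rowC-≤ : ∀ m x → sum (C m x) ≤ 1 + sum (A x) * geomSum q m
    rowC-≤ zero x = ≤-trans (≤-reflexive (rowδ x)) (m≤m+n 1 _)
    rowC-≤ (suc m) x = begin
      sum (C (suc m) x)                                         ≡⟨ ∑-distrib-+ (C m x) (N (suc m) x) ⟩
      sum (C m x) + sum (N (suc m) x)                           ≤⟨ +-mono-≤ (rowC-≤ m x) (rowN-≤ m x) ⟩
      1 + (sum (A x) * geomSum q m + sum (A x) * q ^ m)         ≡⟨ cong suc
          (sym (*-distribˡ-+ (sum (A x)) (geomSum q m) (q ^ m))) ⟩
      1 + sum (A x) * geomSum q (suc m)                         ∎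
      where open ≤-Reasoning

  -- Symmetry of the walk matrices, and commutation with the adjacency matrix.

  AN : (V → V → ℕ) → V → V → ℕ
  AN M x z = sum (λ u → A x u * M u z)

  -- For symmetric `M`, `Sym (AN M)` says that `M` commutes with the adjacency matrix; in this form
  -- no product from the right is needed.
  Sym : (V → V → ℕ) → Set
  Sym M = ∀ x z → M x z ≡ M z x

  -- Since AM = MA, the product A(AM) equals AMA, which is symmetric.
  AAN-sym : ∀ {M} → Sym M → Sym (AN M) → Sym (AN (AN M))
  AAN-sym {M} M-sym AM-sym x z = begin
    sum (λ u → A x u * AN M u z)                        ≡⟨ sum-cong-≗ (λ u → cong (A x u *_) (AM-sym u z)) ⟩
    sum (λ u → A x u * sum (λ v → A z v * M v u))       ≡⟨ sum-cong-≗
        (λ u → *-distribˡ-sum (A x u) (λ v → A z v * M v u)) ⟩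
    sum (λ u → sum (λ v → A x u * (A z v * M v u)))     ≡⟨ ∑-comm (λ u v → A x u * (A z v * M v u)) ⟩
    sum (λ v → sum (λ u → A x u * (A z v * M v u)))     ≡⟨ sum-cong-≗
        (λ v → sum-cong-≗ (λ u → trans (cong (λ t → A x u * (A z v * t)) (M-sym v u))
        (solve 3 (λ a b c → a :* (b :* c) := b :* (a :* c)) refl (A x u) (A z v) (M u v)))) ⟩
    sum (λ v → sum (λ u → A z v * (A x u * M u v)))     ≡⟨ sum-cong-≗
        (λ v → *-distribˡ-sum (A z v) (λ u → A x u * M u v)) ⟨
    sum (λ v → A z v * sum (λ u → A x u * M u v))       ≡⟨ sum-cong-≗ (λ v → cong (A z v *_) (AM-sym v x)) ⟨
    sum (λ v → A z v * AN M v x)                        ∎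
    where
    open ≡-Reasoning
    open +-*-Solver

  AN-+ : ∀ M M′ x z → AN (λ u v → M u v + M′ u v) x z ≡ AN M x z + AN M′ x z
  AN-+ M M′ x z = trans (sum-cong-≗ (λ u → *-distribˡ-+ (A x u) (M u z) (M′ u z)))
                    (∑-distrib-+ (λ u → A x u * M u z) (λ u → A x u * M′ u z))

  AN-* : ∀ c M x z → AN (λ u v → c * M u v) x z ≡ c * AN M x z
  AN-* c M x z = trans (sum-cong-≗ (λ u → solve 3 (λ a b c → a :* (b :* c) := b :* (a :* c)) refl (A x u) c
      (M u z)))
                   (sym (*-distribˡ-sum c (λ u → A x u * M u z)))
    where open +-*-Solver

  AN-cong : ∀ {M M′} → (∀ x z → M x z ≡ M′ x z) → ∀ x z → AN M x z ≡ AN M′ x z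
  AN-cong M≡ x z = sum-cong-≗ (λ u → cong (A x u *_) (M≡ u z))

  sym-cancel : ∀ {M₁ M₂ M₃} c → (∀ x z → M₁ x z ≡ M₂ x z + c * M₃ x z) → Sym M₁ → Sym M₃ → Sym M₂
  sym-cancel {M₁} {M₂} {M₃} c eq s₁ s₃ x z = +-cancelʳ-≡ (c * M₃ x z) (M₂ x z) (M₂ z x) (begin
    M₂ x z + c * M₃ x z   ≡⟨ eq x z ⟨
    M₁ x z                ≡⟨ s₁ x z ⟩
    M₁ z x                ≡⟨ eq z x ⟩
    M₂ z x + c * M₃ z x   ≡⟨ cong (λ t → M₂ z x + c * t) (s₃ z x) ⟩
    M₂ z x + c * M₃ x z   ∎)
    where open ≡-Reasoning

  NSym : ℕ → Set
  NSym k = Sym (N k) × Sym (AN (N k))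

  module _ {q : ℕ} (deg≡ : ∀ x → sum (A x) ≡ suc q) where

    rowP-≡ : ∀ k {p x} → p ~ x → sum (P k p x) ≡ q ^ k
    rowP-≡ zero {p} {x} p~x = rowδ x
    rowP-≡ (suc k) {p} {x} p~x = begin
      sum (P (suc k) p x)                             ≡⟨ rowP-rec k p x ⟩
      sum (λ y → A x y * (ne p y * sum (P k x y)))    ≡⟨ sum-cong-≗
          (λ y → A-*-cong x y (λ x~y → cong (ne p y *_) (rowP-≡ k x~y))) ⟩
      sum (λ y → A x y * (ne p y * q ^ k))            ≡⟨ sum-cong-≗ (λ y → sym (*-assoc (A x y) (ne p y) _)) ⟩
      sum (λ y → A x y * ne p y * q ^ k)              ≡⟨ Σ*const (λ y → A x y * ne p y) (q ^ k) ⟩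
      sum (λ y → A x y * ne p y) * q ^ k              ≡⟨ cong (_* q ^ k)
          (suc-injective (trans (ΣA-ne p~x) (deg≡ x))) ⟩
      q * q ^ k                                       ∎
      where open ≡-Reasoning

    rowC-≡ : ∀ m x → sum (C m x) ≡ 1 + suc q * geomSum q m
    rowC-≡ zero x = trans (rowδ x) (cong suc (sym (*-zeroʳ q)))
    rowC-≡ (suc m) x = begin
      sum (C (suc m) x)                                 ≡⟨ ∑-distrib-+ (C m x) (N (suc m) x) ⟩
      sum (C m x) + sum (N (suc m) x)                   ≡⟨ cong₂ _+_ (rowC-≡ m x) rowN ⟩
      1 + (suc q * geomSum q m + suc q * q ^ m)         ≡⟨ cong suc
          (sym (*-distribˡ-+ (suc q) (geomSum q m) (q ^ m))) ⟩
      1 + suc q * geomSum q (suc m)                     ∎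
      where
      open ≡-Reasoning
      rowN : sum (N (suc m) x) ≡ suc q * q ^ m
      rowN = begin
        sum (N (suc m) x)                   ≡⟨ rowN-rec m x ⟩
        sum (λ y → A x y * sum (P m x y))   ≡⟨ sum-cong-≗ (λ y → A-*-cong x y (rowP-≡ m)) ⟩
        sum (λ y → A x y * q ^ m)           ≡⟨ Σ*const (A x) (q ^ m) ⟩
        sum (A x) * q ^ m                   ≡⟨ cong (_* q ^ m) (deg≡ x) ⟩
        suc q * q ^ m                       ∎

    -- The number of neighbours `u` of `x` that a given walk of length `k` from `x` does not step to
    -- first: all of them for the empty walk, all but one otherwise.
    κ : ℕ → ℕ
    κ zero = suc q
    κ (suc k) = q

    ΣA-P : ∀ k x z → sum (λ u → A x u * P k u x z) ≡ κ k * N k x z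
    ΣA-P zero x z = trans (Σ*const (A x) (δ x z)) (cong (_* δ x z) (deg≡ x))
    ΣA-P (suc k) x z = begin
      sum (λ u → A x u * sum (λ y → A x y * (ne u y * P k x y z)))
        ≡⟨ sum-cong-≗ (λ u → *-distribˡ-sum (A x u) (λ y → A x y * (ne u y * P k x y z))) ⟩
      sum (λ u → sum (λ y → A x u * (A x y * (ne u y * P k x y z))))
        ≡⟨ ∑-comm (λ u y → A x u * (A x y * (ne u y * P k x y z))) ⟩
      sum (λ y → sum (λ u → A x u * (A x y * (ne u y * P k x y z))))
        ≡⟨ sum-cong-≗ inner ⟩
      sum (λ y → q * (A x y * P k x y z))
        ≡⟨ sym (*-distribˡ-sum q (λ y → A x y * P k x y z)) ⟩
      q * N (suc k) x z ∎
      where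
      open ≡-Reasoning
      open +-*-Solver
      inner : ∀ y → sum (λ u → A x u * (A x y * (ne u y * P k x y z))) ≡ q * (A x y * P k x y z)
      inner y = begin
        sum (λ u → A x u * (A x y * (ne u y * P k x y z)))
          ≡⟨ sum-cong-≗ (λ u → trans (cong (λ t → A x u * (A x y * (t * P k x y z))) (ne-sym u y))
               (solve 4 (λ a b c d → a :* (b :* (c :* d)) := (a :* c) :* (b :* d)) refl (A x u) (A x y)
                   (ne y u) (P k x y z))) ⟩
        sum (λ u → A x u * ne y u * (A x y * P k x y z))
          ≡⟨ Σ*const (λ u → A x u * ne y u) (A x y * P k x y z) ⟩
        sum (λ u → A x u * ne y u) * (A x y * P k x y z)
          ≡⟨ solve 3 (λ s a b → s :* (a :* b) := a :* (s :* b)) refl (sum (λ u → A x u * ne y u)) (A x y)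
              (P k x y z) ⟩
        A x y * (sum (λ u → A x u * ne y u) * P k x y z)
          ≡⟨ A-*-cong x y (λ x~y → cong (_* P k x y z) (suc-injective (trans (ΣA-ne (~-sym x~y)) (deg≡ x)))) ⟩
        A x y * (q * P k x y z)
          ≡⟨ solve 3 (λ s a b → a :* (s :* b) := s :* (a :* b)) refl q (A x y) (P k x y z) ⟩
        q * (A x y * P k x y z) ∎

    -- After a step from `x` to `u`, the walk either goes on to a vertex other than `x`, or returns
    -- to `x` at once and continues from there with a walk that does not begin with `u`.
    AN-step : ∀ k x z → AN (N (suc k)) x z ≡ N (2 + k) x z + κ k * N k x z
    AN-step k x z = begin
      sum (λ u → A x u * sum (λ y → A u y * P k u y z))
        ≡⟨ sum-cong-≗ (λ u → cong (A x u *_) (peel u)) ⟩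
      sum (λ u → A x u * (P (suc k) x u z + A u x * P k u x z))
        ≡⟨ sum-cong-≗ (λ u → trans (*-distribˡ-+ (A x u) (P (suc k) x u z) (A u x * P k u x z))
            (cong (A x u * P (suc k) x u z +_) (idem u))) ⟩
      sum (λ u → A x u * P (suc k) x u z + A x u * P k u x z)
        ≡⟨ ∑-distrib-+ (λ u → A x u * P (suc k) x u z) (λ u → A x u * P k u x z) ⟩
      N (2 + k) x z + sum (λ u → A x u * P k u x z)
        ≡⟨ cong (N (2 + k) x z +_) (ΣA-P k x z) ⟩
      N (2 + k) x z + κ k * N k x z ∎
      where
      open ≡-Reasoning
      open +-*-Solver
      idem : ∀ u → A x u * (A u x * P k u x z) ≡ A x u * P k u x z
      idem u = trans (sym (*-assoc (A x u) (A u x) _))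
          (cong (_* P k u x z) (trans (cong (A x u *_) (A-sym u x)) (A-idem x u)))
      peel : ∀ u → sum (λ y → A u y * P k u y z) ≡ P (suc k) x u z + A u x * P k u x z
      peel u = begin
        sum (λ y → A u y * P k u y z)
          ≡⟨ sum-split x (λ y → A u y * P k u y z) ⟩
        A u x * P k u x z + sum (λ y → ne x y * (A u y * P k u y z))
          ≡⟨ +-comm (A u x * P k u x z) _ ⟩
        sum (λ y → ne x y * (A u y * P k u y z)) + A u x * P k u x z
          ≡⟨ cong (_+ A u x * P k u x z) (sum-cong-≗
              (λ y → solve 3 (λ a b c → a :* (b :* c) := b :* (a :* c)) refl (ne x y) (A u y) (P k u y z))) ⟩
        P (suc k) x u z + A u x * P k u x z ∎

    -- The recurrence `AN-step` has order two, so two consecutive lengths are carried through the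
    -- induction.
    N-sym : ∀ k → NSym k × NSym (suc k)
    N-sym zero = (δ-sym , sym-AN₀) , (sym-N₁ , sym-AN₁)
      where
      AN₀≡A : ∀ x z → AN (N 0) x z ≡ A x z
      AN₀≡A x z = trans (sum-cong-≗ (λ u → trans (*-comm (A x u) _) (cong (_* A x u) (δ-sym u z))))
          (sum-δ z (A x))
      sym-AN₀ : Sym (AN (N 0))
      sym-AN₀ x z = trans (AN₀≡A x z) (trans (A-sym x z) (sym (AN₀≡A z x)))
      sym-N₁ : Sym (N 1)
      sym-N₁ = sym-AN₀
      sym-AN₁ : Sym (AN (N 1))
      sym-AN₁ = AAN-sym δ-sym sym-AN₀
    N-sym (suc k) with N-sym k
    ... | (s , as) , (s′ , as′) = (s′ , as′) , (sym-cancel (κ k) (AN-step k) as′ s , sym-cancel (κ k) eq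
        (AAN-sym s′ as′) as)
      where
      eq : ∀ x z → AN (AN (N (suc k))) x z ≡ AN (N (2 + k)) x z + κ k * AN (N k) x z
      eq x z = trans (AN-cong (AN-step k) x z)
        (trans (AN-+ (N (2 + k)) (λ u v → κ k * N k u v) x z)
            (cong (AN (N (2 + k)) x z +_) (AN-* (κ k) (N k) x z)))

    C-sym : ∀ m → Sym (C m) × Sym (AN (C m))
    C-sym zero = proj₁ (N-sym 0)
    C-sym (suc m) with C-sym m | proj₂ (N-sym m)
    ... | s , as | s′ , as′ = (λ x z → cong₂ _+_ (s x z) (s′ x z)) , λ x z →
      trans (AN-+ (C m) (N (suc m)) x z) (trans (cong₂ _+_ (as x z) (as′ x z))
          (sym (AN-+ (C m) (N (suc m)) z x)))

  -- Non-backtracking walks as sequences of vertices.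

  -- Non-backtracking walks; only the values at 0, …, k matter.
  record IsPath (f : ℕ → V) (k : ℕ) : Set where
    field
      edge : ∀ i → i < k → f i ~ f (suc i)
      nb   : ∀ i → 2 + i ≤ k → f i ≢ f (2 + i)
  open IsPath public

  record Path (x y : V) (k : ℕ) : Set where
    field
      at     : ℕ → V
      isPath : IsPath at k
      start  : at 0 ≡ x
      end    : at k ≡ y
  open Path public

  first : ∀ {x y k} → Path x y k → V
  first p = at p 1

  -- f 0, …, f a, g 0, g 1, …
  glue : ℕ → (ℕ → V) → (ℕ → V) → ℕ → V
  glue a f g zero = f zero
  glue zero f g (suc i) = g i
  glue (suc a) f g (suc i) = glue a (f ∘ suc) g i

  glue-left : ∀ a f g i → i ≤ a → glue a f g i ≡ f i
  glue-left a f g zero i≤a = refl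
  glue-left (suc a) f g (suc i) i≤a = glue-left a (f ∘ suc) g i (s≤s⁻¹ i≤a)

  glue-right : ∀ a f g i → glue a f g (suc (a + i)) ≡ g i
  glue-right zero f g i = refl
  glue-right (suc a) f g i = glue-right a (f ∘ suc) g i

  tail-isPath : ∀ {f k} → IsPath f (suc k) → IsPath (f ∘ suc) k
  tail-isPath p .edge i i<k = edge p (suc i) (s≤s i<k)
  tail-isPath p .nb i i≤k = nb p (suc i) (s≤s i≤k)

  take-isPath : ∀ {f k l} → l ≤ k → IsPath f k → IsPath f l
  take-isPath l≤k p .edge i i<l = edge p i (≤-trans i<l l≤k)
  take-isPath l≤k p .nb i i≤l = nb p i (≤-trans i≤l l≤k)

  -- Backtracking can only arise at the two pairs at index distance two that straddle the new edge.
  -- The last two hypotheses exclude it there, each only if the vertex in question exists.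
  glue-isPath : ∀ a b {f g} → IsPath f a → IsPath g b → f a ~ g 0 →
                (∀ j → suc j ≡ a → f j ≢ g 0) → (1 ≤ b → f a ≢ g 1) →
                IsPath (glue a f g) (suc (a + b))
  glue-isPath zero b pf pg e nbˡ nbʳ .edge zero _ = e
  glue-isPath zero b pf pg e nbˡ nbʳ .edge (suc i) i<b = edge pg i (s≤s⁻¹ i<b)
  glue-isPath zero b pf pg e nbˡ nbʳ .nb zero b≥1 = nbʳ (s≤s⁻¹ b≥1)
  glue-isPath zero b pf pg e nbˡ nbʳ .nb (suc i) i≤b = nb pg i (s≤s⁻¹ i≤b)
  glue-isPath (suc a) b pf pg e nbˡ nbʳ .edge zero _ = edge pf 0 (s≤s z≤n)
  glue-isPath (suc a) b pf pg e nbˡ nbʳ .edge (suc i) i< =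
    glue-isPath a b (tail-isPath pf) pg e (λ j eq → nbˡ (suc j) (cong suc eq)) nbʳ .edge i (s≤s⁻¹ i<)
  glue-isPath (suc zero) b pf pg e nbˡ nbʳ .nb zero _ = nbˡ 0 refl
  glue-isPath (suc (suc a)) b pf pg e nbˡ nbʳ .nb zero _ = nb pf 0 (s≤s (s≤s z≤n))
  glue-isPath (suc a) b pf pg e nbˡ nbʳ .nb (suc i) i≤ =
    glue-isPath a b (tail-isPath pf) pg e (λ j eq → nbˡ (suc j) (cong suc eq)) nbʳ .nb i (s≤s⁻¹ i≤)

  suc[m∸sucn]≡m∸n : ∀ {m n} → n < m → suc (m ∸ suc n) ≡ m ∸ n
  suc[m∸sucn]≡m∸n n<m = sym (+-∸-assoc 1 n<m)

  reverse-isPath : ∀ {f k} → IsPath f k → IsPath (λ i → f (k ∸ i)) k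
  reverse-isPath {f} {k} p .edge i i<k =
    ~-sym (subst (λ j → f (k ∸ suc i) ~ f j) (suc[m∸sucn]≡m∸n i<k)
        (edge p (k ∸ suc i) (≤-trans (≤-reflexive (suc[m∸sucn]≡m∸n i<k)) (m∸n≤m k i))))
  reverse-isPath {f} {k} p .nb i i≤k =
    subst (λ j → f j ≢ f (k ∸ (2 + i))) eq (λ e → nb p (k ∸ (2 + i)) (≤-trans (≤-reflexive eq) (m∸n≤m k i))
        (sym e))
    where
    eq : 2 + (k ∸ (2 + i)) ≡ k ∸ i
    eq = trans (cong suc (suc[m∸sucn]≡m∸n i≤k)) (suc[m∸sucn]≡m∸n (<-trans (n<1+n i) i≤k))

  reverse : ∀ {x y k} → Path x y k → Path y x k
  reverse {k = k} p .at i = at p (k ∸ i)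
  reverse p .isPath = reverse-isPath (isPath p)
  reverse p .start = end p
  reverse {k = k} p .end = trans (cong (at p) (n∸n≡0 k)) (start p)

  cons : ∀ {x y z k} → x ~ y → (p : Path y z k) → (1 ≤ k → x ≢ first p) → Path x z (suc k)
  cons {x} x~y p nbᵣ .at = glue 0 (λ _ → x) (at p)
  cons {x} x~y p nbᵣ .isPath = glue-isPath 0 _ (record { edge = λ _ () ; nb = λ _ () }) (isPath p)
    (subst (x ~_) (sym (start p)) x~y) (λ _ ()) nbᵣ
  cons x~y p nbᵣ .start = refl
  cons x~y p nbᵣ .end = end p

  tail : ∀ {x z k} (p : Path x z (suc k)) → Path (first p) z k
  tail p .at = at p ∘ suc
  tail p .isPath = tail-isPath (isPath p)
  tail p .start = refl
  tail p .end = end p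

  take : ∀ {x y k} (p : Path x y k) l → l ≤ k → Path x (at p l) l
  take p l l≤k .at = at p
  take p l l≤k .isPath = take-isPath l≤k (isPath p)
  take p l l≤k .start = start p
  take p l l≤k .end = refl

  castEnd : ∀ {x y y′ k} → y ≡ y′ → Path x y k → Path x y′ k
  castEnd e p .at = at p
  castEnd e p .isPath = isPath p
  castEnd e p .start = start p
  castEnd e p .end = trans (end p) e

  castStart : ∀ {x x′ y k} → x ≡ x′ → Path x y k → Path x′ y k
  castStart e p .at = at p
  castStart e p .isPath = isPath p
  castStart e p .start = trans (start p) e
  castStart e p .end = end p

  empty : ∀ {x} → Path x x 0
  empty {x} .at _ = x
  empty .isPath = record { edge = λ _ () ; nb = λ _ () }
  empty .start = refl
  empty .end = refl

  first~ : ∀ {x y k} (p : Path x y (suc k)) → x ~ first p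
  first~ p = subst (_~ first p) (start p) (edge (isPath p) 0 (s≤s z≤n))

  -- p backwards, then q
  fork : ∀ {x y z a b} (p : Path x y a) (q : Path x z (suc b)) → (1 ≤ a → first p ≢ first q) → Path y z
      (suc (a + b))
  fork {a = a} p q f≢ .at = glue a (at (reverse p)) (at q ∘ suc)
  fork {x} {a = a} {b} p q f≢ .isPath = glue-isPath a b (isPath (reverse p)) (isPath (tail q))
    (subst (_~ first q) (sym (end (reverse p))) (first~ q))
    (λ { j refl → subst (λ i → at p i ≢ first q)
        (sym (trans (+-∸-assoc 1 (≤-refl {j})) (cong suc (n∸n≡0 j)))) (f≢ (s≤s z≤n)) })
    (λ { (s≤s z≤n) e → nb (isPath q) 0 (s≤s (s≤s z≤n)) (trans (start q) (trans (sym (end (reverse p))) e)) })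
  fork p q f≢ .start = end p
  fork {a = a} {b} p q f≢ .end = trans (glue-right a (at (reverse p)) (at q ∘ suc) b) (end q)

  fork-left : ∀ {x y z a b} (p : Path x y a) (q : Path x z (suc b)) f≢ i → i ≤ a → at (fork p q f≢) i ≡ at p
      (a ∸ i)
  fork-left {a = a} p q f≢ i i≤a = glue-left a (at (reverse p)) (at q ∘ suc) i i≤a

  fork-right : ∀ {x y z a b} (p : Path x y a) (q : Path x z (suc b)) f≢ i → at (fork p q f≢) (suc (a + i)) ≡
      at q (suc i)
  fork-right {a = a} p q f≢ i = glue-right a (at (reverse p)) (at q ∘ suc) i

  -- A first step that is undone by the next one cancels against it, which shortens the walk by two.
  Walk⇒Path : ∀ {j u v} → Walk G j u v → ∃ λ k → k ≤ j × Path u v k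
  Walk⇒Path here = 0 , z≤n , empty
  Walk⇒Path {u = u} (step u~w ω) with Walk⇒Path ω
  ... | zero , _ , p = 1 , s≤s z≤n , cons u~w p (λ ())
  ... | suc k , k≤j , p with first p Fin.≟ u
  ... | yes eq = k , ≤-trans (≤-trans (n≤1+n k) k≤j) (n≤1+n _) , subst (λ x → Path x _ k) eq (tail p)
  ... | no ≢u = 2 + k , s≤s k≤j , cons u~w p (λ _ e → ≢u (sym e))

  -- Positive counts versus actual walks.

  1≤* : ∀ {a b} → 1 ≤ a → 1 ≤ b → 1 ≤ a * b
  1≤* 1≤a 1≤b = *-mono-≤ 1≤a 1≤b

  -- The excluded vertex is prepended: walks of length `k` from `x` that do not start with `p`
  -- correspond to non-backtracking walks of length `suc k` from `p` with first step `x`.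
  P-pos : ∀ k {f} → IsPath f (suc k) → 1 ≤ P k (f 0) (f 1) (f (suc k))
  P-pos zero {f} p = ≤-reflexive (sym (δ-refl (f 1)))
  P-pos (suc k) {f} p = ≤-trans
    (1≤* (≤-reflexive (sym (~⇒A≡1 (edge p 1 (s≤s (s≤s z≤n))))))
         (1≤* (≤-reflexive (sym (ne-≢ (nb p 0 (s≤s (s≤s z≤n)))))) (P-pos k (tail-isPath p))))
    (sum-≥1 (λ y → A (f 1) y * (ne (f 0) y * P k (f 1) y (f (2 + k)))) (f 2))

  P⇒Path : ∀ k {p x z} → p ~ x → 1 ≤ P k p x z → ∃ λ (π : Path p z (suc k)) → first π ≡ x
  P⇒Path zero {p} {x} {z} p~x 1≤P = cons p~x (subst (λ v → Path x v 0) (δ-pos 1≤P) empty) (λ ()) , start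
      (subst (λ v → Path x v 0) (δ-pos 1≤P) empty)
  P⇒Path (suc k) {p} {x} {z} p~x 1≤P with sum-pos _ 1≤P
  ... | y , 1≤y with *-pos (A x y) 1≤y
  ... | 1≤A , 1≤y′ with *-pos (ne p y) 1≤y′
  ... | 1≤ne , 1≤P′ with P⇒Path k (A-pos 1≤A) 1≤P′
  ... | π , refl = cons p~x π (λ _ → ne-pos 1≤ne) , start π

  P≤Q : ∀ {k m} p x z → k < m → P k p x z ≤ Q m p x z
  P≤Q {k} {suc m} p x z k<m with m≤n⇒m<n∨m≡n (s≤s⁻¹ k<m)
  ... | inj₁ k<m′ = ≤-trans (P≤Q p x z k<m′) (m≤m+n _ _)
  ... | inj₂ refl = m≤n+m _ _

  Q-pos : ∀ m {p x z} → 1 ≤ Q m p x z → ∃ λ k → k < m × 1 ≤ P k p x z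
  Q-pos (suc m) {p} {x} {z} 1≤Q with Q m p x z in eq
  ... | zero = m , n<1+n m , 1≤Q
  ... | suc _ with Q-pos m (subst (1 ≤_) (sym eq) (s≤s z≤n))
  ... | k , k<m , 1≤P = k , m<n⇒m<1+n k<m , 1≤P

  Q⇒Path : ∀ m {p x z} → p ~ x → 1 ≤ Q m p x z → ∃ λ k → k < m × ∃ λ (π : Path p z (suc k)) → first π ≡ x
  Q⇒Path m p~x 1≤Q with Q-pos m 1≤Q
  ... | k , k<m , 1≤P = k , k<m , P⇒Path k p~x 1≤P

  AQ-pos : ∀ {x y k m} (π : Path x y (suc k)) → k < m → 1 ≤ A x (first π) * Q m x (first π) y
  AQ-pos {k = k} {m} π k<m = 1≤* (≤-reflexive (sym (~⇒A≡1 (first~ π))))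
    (≤-trans (subst₂ (λ u v → 1 ≤ P k u (first π) v) (start π) (end π) (P-pos k (isPath π))) (P≤Q _ _ _ k<m))

  Path⇒C-pos : ∀ {x y k m} → Path x y k → k ≤ m → 1 ≤ C m x y
  Path⇒C-pos {x} {y} {zero} {m} π k≤m = subst (1 ≤_) (sym (C-rec m x y))
    (≤-trans (≤-reflexive (sym (trans (cong (δ x) (trans (sym (end π)) (start π))) (δ-refl x)))) (m≤m+n _ _))
  Path⇒C-pos {x} {y} {suc k} {m} π k≤m = subst (1 ≤_) (sym (C-rec m x y))
    (≤-trans (≤-trans (AQ-pos π k≤m) (sum-≥1 (λ u → A x u * Q m x u y) (first π))) (m≤n+m _ _))

  Closed : ℕ → Set
  Closed c = ∃ λ x → Path x x c

  *-≥2 : ∀ {a b} → a ≤ 1 → 2 ≤ a * b → 1 ≤ a × 2 ≤ b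
  *-≥2 {suc zero} {b} _ 2≤ = s≤s z≤n , subst (2 ≤_) (+-identityʳ b) 2≤
  *-≥2 {suc (suc a)} (s≤s ()) _

  ne-≤1 : ∀ (x y : V) → ne x y ≤ 1
  ne-≤1 x y = ≤-trans (m≤m+n _ _) (≤-reflexive (ne+δ x y))

  two-in-sum : (f : V → ℕ) → 2 ≤ sum f →
               (∃ λ u → 2 ≤ f u) ⊎ (∃ λ u → ∃ λ v → u ≢ v × 1 ≤ f u × 1 ≤ f v)
  two-in-sum f 2≤Σ with sum-pos f (≤-trans (s≤s z≤n) 2≤Σ)
  ... | u , 1≤fu with 2 ≤? f u
  ... | yes 2≤fu = inj₁ (u , 2≤fu)
  ... | no 2≰fu with sum-pick (u ∷ []) f (≤-<-trans (≤-reflexive (+-identityʳ (f u)))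
      (<-≤-trans (≰⇒> 2≰fu) 2≤Σ))
  ... | v , v∉ , 1≤fv = inj₂ (u , v , (λ e → v∉ (here (sym e))) , 1≤fu , 1≤fv)

  -- As long as two walks share their first step, it is removed from both. Once the first steps
  -- differ, one walk reversed and then the other form a closed walk at `z`. If `x` is `z`, the
  -- empty walk accounts for only one of the two, and a nonempty one is closed by itself.
  Q≥2⇒Closed : ∀ m {p x z} → 2 ≤ Q (suc m) p x z → ∃ λ c → 1 ≤ c × c ≤ m + m × Closed c
  Q≥2⇒Closed m {p} {x} {z} 2≤Q with x Fin.≟ z
  Q≥2⇒Closed m {p} {x} {.x} 2≤Q | yes refl
    with sum-pos _ (s≤s⁻¹ (subst (2 ≤_)
        (trans (Q-rec m p x x) (cong (_+ sum (λ y → A x y * (ne p y * Q m x y x))) (δ-refl x))) 2≤Q))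
  ... | y , 1≤y with *-pos (A x y) 1≤y
  ... | 1≤A , 1≤y′ with Q⇒Path m (A-pos 1≤A) (proj₂ (*-pos (ne p y) 1≤y′))
  ... | k , k<m , π , _ = suc k , s≤s z≤n , ≤-trans k<m (m≤m+n m m) , x , π
  Q≥2⇒Closed m {p} {x} {z} 2≤Q | no x≢z
    with two-in-sum _ (subst (2 ≤_)
        (trans (Q-rec m p x z) (cong (_+ sum (λ y → A x y * (ne p y * Q m x y z))) (δ-≢ x≢z))) 2≤Q)
  Q≥2⇒Closed (suc m) {p} {x} {z} 2≤Q | no x≢z | inj₁ (y , 2≤y)
    with *-≥2 (A-≤1 x y) 2≤y
  ... | _ , 2≤y′ with Q≥2⇒Closed m {x} {y} {z} (proj₂ (*-≥2 (ne-≤1 p y) 2≤y′))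
  ... | c , 1≤c , c≤ , cl = c , 1≤c , ≤-trans c≤ (+-mono-≤ (n≤1+n m) (n≤1+n m)) , cl
  Q≥2⇒Closed zero {p} {x} {z} 2≤Q | no x≢z | inj₁ (y , 2≤y)
    with *-≥2 (A-≤1 x y) 2≤y
  ... | _ , 2≤y′ with *-≥2 (ne-≤1 p y) 2≤y′
  ... | _ , ()
  Q≥2⇒Closed m {p} {x} {z} 2≤Q | no x≢z | inj₂ (u , v , u≢v , 1≤u , 1≤v)
    with *-pos (A x u) 1≤u | *-pos (A x v) 1≤v
  ... | x~u , 1≤u′ | x~v , 1≤v′
    with Q⇒Path m (A-pos x~u) (proj₂ (*-pos (ne p u) 1≤u′)) | Q⇒Path m (A-pos x~v) (proj₂ (*-pos (ne p v) 1≤v′))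
  ... | k , k<m , π , refl | l , l<m , ρ , refl =
    suc (suc k + l) , s≤s z≤n , ≤-trans (≤-reflexive (sym (+-suc (suc k) l))) (+-mono-≤ k<m l<m) , z , fork
        π ρ (λ _ → u≢v)

  -- Repeats of a vertex, and the girth.

  module Repeats (D : ℕ) (4≤D : 4 ≤ D) (r₁ r₂ : V → V)
    (C≡ : ∀ x y → C D x y ≡ suc (δ y (r₁ x) + δ y (r₂ x))) where

    R : V → V → Set
    R x y = (y ≡ r₁ x) ⊎ (y ≡ r₂ x)

    1≤D : 1 ≤ D
    1≤D = ≤-trans (s≤s z≤n) 4≤D

    -- The number of non-backtracking walks from `x` to `y` of positive length at most `D` with
    -- first step `u`.
    AQ : V → V → V → ℕ
    AQ x y u = A x u * Q D x u y

    C-split : ∀ x y → δ x y + sum (AQ x y) ≡ suc (δ y (r₁ x) + δ y (r₂ x))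
    C-split x y = trans (sym (C-rec D x y)) (C≡ x y)

    Σ≤ : ∀ x y → sum (AQ x y) ≤ suc (δ y (r₁ x) + δ y (r₂ x))
    Σ≤ x y = ≤-trans (m≤n+m _ (δ x y)) (≤-reflexive (C-split x y))

    δ+δ-pos : ∀ {x y} → 1 ≤ δ y (r₁ x) + δ y (r₂ x) → R x y
    δ+δ-pos {x} {y} 1≤ with y Fin.≟ r₁ x
    ... | yes e = inj₁ e
    ... | no _ = inj₂ (δ-pos 1≤)

    AQ≥1 : ∀ {x y a} (p : Path x y a) → 1 ≤ a → a ≤ D → 1 ≤ AQ x y (first p)
    AQ≥1 p (s≤s _) a≤D = AQ-pos p a≤D

    -- Different first steps contribute to different summands of the walk count, which exceeds by at
    -- most one the multiplicity of `y` among the repeats of `x`.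
    two-paths⇒R : ∀ {x y a b} (p : Path x y a) (q : Path x y b) → 1 ≤ a → a ≤ D → 1 ≤ b → b ≤ D →
                  first p ≢ first q → R x y
    two-paths⇒R {x} {y} p q 1≤a a≤D 1≤b b≤D p≢q = δ+δ-pos (s≤s⁻¹
      (≤-trans (+-mono-≤ (AQ≥1 p 1≤a a≤D) (AQ≥1 q 1≤b b≤D)) (≤-trans (sum-≥2 (AQ x y) p≢q) (Σ≤ x y))))

    three-paths⇒double : ∀ {x y a b c} (p : Path x y a) (q : Path x y b) (r : Path x y c) →
      1 ≤ a → a ≤ D → 1 ≤ b → b ≤ D → 1 ≤ c → c ≤ D →
      first p ≢ first q → first p ≢ first r → first q ≢ first r → r₁ x ≡ y × r₂ x ≡ y
    three-paths⇒double {x} {y} p q r 1≤a a≤D 1≤b b≤D 1≤c c≤D p≢q p≢r q≢r = both (s≤s⁻¹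
      (≤-trans (+-mono-≤ (AQ≥1 p 1≤a a≤D) (+-mono-≤ (AQ≥1 q 1≤b b≤D) (AQ≥1 r 1≤c c≤D)))
        (≤-trans (sum-≥3 (AQ x y) p≢q p≢r q≢r) (Σ≤ x y))))
      where
      both : 2 ≤ δ y (r₁ x) + δ y (r₂ x) → r₁ x ≡ y × r₂ x ≡ y
      both 2≤ with y Fin.≟ r₁ x | y Fin.≟ r₂ x
      both 2≤ | yes e | yes e′ = sym e , sym e′
      both (s≤s ()) | yes _ | no _
      both (s≤s ()) | no _ | yes _
      both () | no _ | no _

    closed⇒R : ∀ {x a} → Path x x a → 1 ≤ a → a ≤ D → R x x
    closed⇒R {x} p 1≤a a≤D = δ+δ-pos (s≤s⁻¹ (subst (2 ≤_) (C-split x x)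
      (+-mono-≤ (≤-reflexive (sym (δ-refl x))) (≤-trans (AQ≥1 p 1≤a a≤D) (sum-≥1 (AQ x x) (first p))))))

    R-≤2 : ∀ {x a b c} → R x a → R x b → R x c → a ≢ b → a ≢ c → b ≢ c → ⊥
    R-≤2 (inj₁ refl) (inj₁ refl) _ a≢b _ _ = a≢b refl
    R-≤2 (inj₂ refl) (inj₂ refl) _ a≢b _ _ = a≢b refl
    R-≤2 (inj₁ refl) (inj₂ refl) (inj₁ refl) _ a≢c _ = a≢c refl
    R-≤2 (inj₁ refl) (inj₂ refl) (inj₂ refl) _ _ b≢c = b≢c refl
    R-≤2 (inj₂ refl) (inj₁ refl) (inj₁ refl) _ _ b≢c = b≢c refl
    R-≤2 (inj₂ refl) (inj₁ refl) (inj₂ refl) _ a≢c _ = a≢c refl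

    -- With distinct first and last steps, the two arcs of the closed walk make three vertices repeats of x.
    no-closed : ∀ c {x} → 1 ≤ c → 2 + c ≤ D + D → Path x x c → ⊥
    no-closed 1 _ _ p = ~-irrefl (subst₂ _~_ (start p) (end p) (edge (isPath p) 0 ≤-refl))
    no-closed 2 _ _ p = nb (isPath p) 0 ≤-refl (trans (start p) (sym (end p)))
    -- If the first and the last step cancel, the interior is a closed walk that is shorter by two.
    no-closed (suc (suc l@(suc c))) {x} _ c≤ p = bySteps
        (λ e → no-closed l (s≤s z≤n) (≤-trans (n≤1+n _) (≤-trans (n≤1+n _) c≤))
          (castEnd (sym e) (take (tail p) l (n≤1+n _))))
      where
      bySteps : (at p 1 ≡ at p (2 + c) → ⊥) → ⊥
      bySteps 1≢ = byLength (3 + c ≤? D)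
        where
        arc : ∀ i j → i + j ≡ 3 + c → 1 ≤ i → i ≤ D → 1 ≤ j → j ≤ D → R x (at p i)
        arc i j eq 1≤i i≤D 1≤j j≤D = two-paths⇒R (take p i (subst (i ≤_) eq (m≤m+n i j)))
          (castEnd (cong (at p) (trans (cong (_∸ j) (sym eq)) (m+n∸n≡m i j)))
              (take (reverse p) j (subst (j ≤_) eq (m≤n+m j i))))
          1≤i i≤D 1≤j j≤D 1≢
        byLength : Dec (3 + c ≤ D) → ⊥
        -- For length at most `D`, the three repeats are `x` itself and its two neighbours on the
        -- walk.
        byLength (yes c≤D) = R-≤2 (closed⇒R p (s≤s z≤n) c≤D)
          (arc 1 (2 + c) refl (s≤s z≤n) 1≤D (s≤s z≤n) (≤-trans (n≤1+n _) c≤D))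
          (arc (2 + c) 1 (+-comm (2 + c) 1) (s≤s z≤n) (≤-trans (n≤1+n _) c≤D) (s≤s z≤n) 1≤D)
          (λ e → ~-irrefl (subst (λ v → v ~ at p 1) (trans (start p) e) (edge (isPath p) 0 (s≤s z≤n))))
          (λ e → ~-irrefl (subst (λ v → at p (2 + c) ~ v) (trans (end p) e) (edge (isPath p) (2 + c) ≤-refl)))
          1≢
        -- For greater length they are three consecutive vertices: the arcs behind them have lengths
        -- `i`, `i + 1`, `i + 2` and the arcs ahead have lengths `D`, `D - 1`, `D - 2`. The bound on
        -- the length of the walk gives `2 + i ≤ D`.
        byLength (no c≰D) = R-≤2
          (arc i D eq₀ 1≤i (≤-trans (≤-trans (n≤1+n _) (n≤1+n _)) i₂≤D) 1≤D ≤-refl)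
          (arc (1 + i) (D ∸ 1) eq₁ (s≤s z≤n) (≤-trans (n≤1+n _) i₂≤D)
              (m<n⇒0<n∸m (≤-trans (s≤s (s≤s z≤n)) 4≤D)) (m∸n≤m D 1))
          (arc (2 + i) (D ∸ 2) eq₂ (s≤s z≤n) i₂≤D (m<n⇒0<n∸m (≤-trans (s≤s (s≤s (s≤s z≤n))) 4≤D)) (m∸n≤m D 2))
          (~⇒≢ (edge (isPath p) i (≤-trans (n≤1+n _) 2+i≤c)))
          (nb (isPath p) i 2+i≤c)
          (~⇒≢ (edge (isPath p) (suc i) 2+i≤c))
          where
          i = 3 + c ∸ D
          D≤c : D ≤ 3 + c
          D≤c = <⇒≤ (≰⇒> c≰D)
          eq₀ : i + D ≡ 3 + c
          eq₀ = m∸n+n≡m D≤c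
          eq₁ : 1 + i + (D ∸ 1) ≡ 3 + c
          eq₁ = trans (sym (+-suc i _)) (trans (cong (i +_) (m+[n∸m]≡n 1≤D)) eq₀)
          eq₂ : 2 + i + (D ∸ 2) ≡ 3 + c
          eq₂ = trans (cong suc (sym (+-suc i _)))
              (trans (sym (+-suc i _)) (trans (cong (i +_) (m+[n∸m]≡n (≤-trans (s≤s (s≤s z≤n)) 4≤D))) eq₀))
          1≤i : 1 ≤ i
          1≤i = m<n⇒0<n∸m (≰⇒> c≰D)
          i₂≤D : 2 + i ≤ D
          i₂≤D = +-cancelʳ-≤ D _ _ (≤-trans (≤-reflexive (cong (2 +_) eq₀)) c≤)
          2+i≤c : 2 + i ≤ 3 + c
          2+i≤c = subst (2 + i ≤_) eq₂ (m≤m+n (2 + i) (D ∸ 2))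

    private
      Σ≥2⇒two-paths : ∀ {x y} → 2 ≤ sum (AQ x y) →
        ∃₂ λ a b → a < D × b < D × ∃₂ λ (p : Path x y (suc a)) (q : Path x y (suc b)) → first p ≢ first q
      -- Two walks with the same first step would yield a closed walk of length at most 2(D - 1),
      -- against `no-closed`.
      AQ≤1 : ∀ x y u → AQ x y u ≤ 1
      AQ≤1 x y u with AQ x y u ≤? 1
      ... | yes ≤1 = ≤1
      ... | no ≰1 with Q≥2⇒Closed (D ∸ 1) {x} {u} {y}
                         (subst (λ m → 2 ≤ Q m x u y) (sym (m+[n∸m]≡n 1≤D)) (proj₂ (*-≥2 (A-≤1 x u) (≰⇒> ≰1))))
      ... | c , 1≤c , c≤ , v , p = ⊥-elim (no-closed c 1≤c (≤-trans (s≤s (s≤s c≤))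
              (≤-reflexive (trans (cong suc (sym (+-suc (D ∸ 1) (D ∸ 1))))
                  (cong₂ _+_ (m+[n∸m]≡n 1≤D) (m+[n∸m]≡n 1≤D))))) p)
      Σ≥2⇒two-paths {x} {y} 2≤Σ with two-in-sum (AQ x y) 2≤Σ
      ... | inj₁ (u , 2≤) = ⊥-elim (<⇒≱ 2≤ (AQ≤1 x y u))
      ... | inj₂ (u , v , u≢v , 1≤u , 1≤v) with *-pos (A x u) 1≤u | *-pos (A x v) 1≤v
      ... | 1≤A , 1≤Q | 1≤A′ , 1≤Q′ with Q⇒Path D (A-pos 1≤A) 1≤Q | Q⇒Path D (A-pos 1≤A′) 1≤Q′
      ... | a , a<D , p , refl | b , b<D , q , refl = a , b , a<D , b<D , p , q , u≢v

    2+D≤D+D : 2 + D ≤ D + D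
    2+D≤D+D = +-monoˡ-≤ D (≤-trans (s≤s (s≤s z≤n)) 4≤D)

    R⇒≢ : ∀ {x y} → R x y → x ≢ y
    R⇒≢ {x} Rxx refl = absurd (sum-pos (AQ x x) 1≤Σ)
      where
      1≤C : R x x → 1 ≤ δ x (r₁ x) + δ x (r₂ x)
      1≤C (inj₁ e) = ≤-trans (≤-reflexive (sym (trans (cong (δ x) (sym e)) (δ-refl x)))) (m≤m+n _ _)
      1≤C (inj₂ e) = ≤-trans (≤-reflexive (sym (trans (cong (δ x) (sym e)) (δ-refl x)))) (m≤n+m _ _)
      1≤Σ : 1 ≤ sum (AQ x x)
      1≤Σ = +-cancelˡ-≤ 1 _ _ (≤-trans (s≤s (1≤C Rxx))
          (≤-reflexive (trans (sym (C-split x x)) (cong (_+ sum (AQ x x)) (δ-refl x)))))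
      absurd : (∃ λ u → 1 ≤ AQ x x u) → ⊥
      absurd (u , 1≤) with *-pos (A x u) 1≤
      ... | 1≤A , 1≤Q with Q⇒Path D (A-pos 1≤A) 1≤Q
      ... | k , k<D , p , _ = no-closed (suc k) (s≤s z≤n) (≤-trans (s≤s (s≤s k<D)) 2+D≤D+D) p

    Σ≡ : ∀ {x y} → R x y → sum (AQ x y) ≡ suc (δ y (r₁ x) + δ y (r₂ x))
    Σ≡ {x} {y} Rxy = trans (cong (_+ sum (AQ x y)) (sym (δ-≢ (R⇒≢ Rxy)))) (C-split x y)

    -- A converse of `two-paths⇒R`: each first step carries at most one walk, so two walks must
    -- differ in their first steps.
    R⇒two-paths : ∀ {x y} → R x y →
      ∃₂ λ a b → a < D × b < D × ∃₂ λ (p : Path x y (suc a)) (q : Path x y (suc b)) → first p ≢ first q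
    R⇒two-paths {x} {y} Rxy = Σ≥2⇒two-paths (subst (2 ≤_) (sym (Σ≡ Rxy)) (s≤s (1≤ Rxy)))
      where
      1≤ : R x y → 1 ≤ δ y (r₁ x) + δ y (r₂ x)
      1≤ (inj₁ e) = ≤-trans (≤-reflexive (sym (trans (cong (δ y) (sym e)) (δ-refl y)))) (m≤m+n _ _)
      1≤ (inj₂ e) = ≤-trans (≤-reflexive (sym (trans (cong (δ y) (sym e)) (δ-refl y)))) (m≤n+m _ _)

    -- There are three walks in total, and at most one of them starts with `s` and one with `t`.
    double⇒third-path : ∀ {x y} → r₁ x ≡ y → r₂ x ≡ y → ∀ s t →
      ∃ λ a → a < D × ∃ λ (p : Path x y (suc a)) → first p ≢ s × first p ≢ t
    double⇒third-path {x} {y} e₁ e₂ s t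
      with sum-pick (s ∷ t ∷ []) (AQ x y) (≤-<-trans (+-mono-≤ (AQ≤1 x y s) (+-mono-≤ (AQ≤1 x y t) z≤n))
          (≤-reflexive (sym Σ≡3)))
      where
      Σ≡3 : sum (AQ x y) ≡ 3
      Σ≡3 = trans (Σ≡ (inj₁ (sym e₁)))
          (cong suc (cong₂ _+_ (trans (cong (δ y) e₁) (δ-refl y)) (trans (cong (δ y) e₂) (δ-refl y))))
    ... | u , u∉ , 1≤u with *-pos (A x u) 1≤u
    ... | 1≤A , 1≤Q with Q⇒Path D (A-pos 1≤A) 1≤Q
    ... | a , a<D , p , refl = a , a<D , p , (λ e → u∉ (here e)) , (λ e → u∉ (there (here e)))

    -- Cycles, unrolled to periodic sequences, and the repeats found on them.

    record Cycle (c : ℕ) (k : ℕ → V) : Set where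
      field
        cyc-edge : ∀ i → k i ~ k (suc i)
        cyc-nb   : ∀ i → k i ≢ k (2 + i)
        cyc-per  : ∀ i → k (i + c) ≡ k i
    open Cycle public

    arc⁺ : ∀ {c k} → Cycle c k → ∀ i l → Path (k i) (k (l + i)) l
    arc⁺ {k = k} K i l .at j = k (j + i)
    arc⁺ K i l .isPath .edge j _ = cyc-edge K (j + i)
    arc⁺ K i l .isPath .nb j _ = cyc-nb K (j + i)
    arc⁺ K i l .start = refl
    arc⁺ K i l .end = refl

    arc⁻ : ∀ {c k} → Cycle c k → ∀ i l j → l + j ≡ c → Path (k i) (k (j + i)) l
    arc⁻ {k = k} K i l j eq = castStart
      (trans (cong k (trans (sym (+-assoc l j i)) (trans (cong (_+ i) eq) (+-comm _ i)))) (cyc-per K i))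
      (reverse (arc⁺ K (j + i) l))

    -- The predecessor of `k i` on a cycle of length `c`. Going almost a full period forward avoids
    -- the index `i - 1`.
    prev : ℕ → (ℕ → V) → ℕ → V
    prev c k i = k (pred c + i)

    first-arc⁻ : ∀ {c k} (K : Cycle c k) i l j (eq : suc l + j ≡ c) → first (arc⁻ K i (suc l) j eq) ≡ prev c k i
    first-arc⁻ {k = k} K i l j refl = cong k (sym (+-assoc l j i))

    prev≢next : ∀ {c k} → Cycle c k → 1 ≤ c → ∀ i → k (suc i) ≢ prev c k i
    prev≢next {suc c} {k} K _ i e = cyc-nb K (c + i)
        (trans (sym e) (sym (trans (cong k (cong suc (+-comm (suc c) i))) (cyc-per K (suc i)))))

    -- The two complementary arcs leave `k i` by different steps.
    cycle-R : ∀ {c k} → Cycle c k → ∀ {a b} → a + b ≡ c → 1 ≤ a → a ≤ D → 1 ≤ b → b ≤ D → ∀ i → R (k i)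
        (k (a + i))
    cycle-R {c} K {a} {suc b} eq 1≤a a≤D 1≤b b≤D i =
      two-paths⇒R (arc⁺ K i a) (arc⁻ K i (suc b) a eq′) 1≤a a≤D 1≤b b≤D
        (λ e → prev≢next K (subst (1 ≤_) eq (≤-trans 1≤a (m≤m+n a _))) i (trans e (first-arc⁻ K i b a eq′)))
      where eq′ = trans (+-comm (suc b) a) eq

    -- The closed walk has distinct first and last steps, as otherwise no-closed applies to its interior.
    closed⇒Cycle : ∀ {x c} → 3 ≤ c → c ≤ D + D → (p : Path x x c) →
      ∃ λ k → Cycle c k × (∀ i → i ≤ c → k i ≡ at p i)
    closed⇒Cycle {x} {suc (suc (suc c))} (s≤s (s≤s (s≤s _))) c≤ p = k , record
        { cyc-edge = ed ; cyc-nb = nonb ; cyc-per = λ i → cong (at p) ([m+n]%n≡m%n i m) } , k≡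
      where
      m = 3 + c
      1≢ : at p (2 + c) ≢ at p 1
      1≢ e = no-closed (suc c) (s≤s z≤n) c≤ (castEnd e (take (tail p) (suc c) (n≤1+n _)))
      k : ℕ → V
      k i = at p (i % m)
      next : ∀ i → (suc i % m ≡ suc (i % m) × suc (i % m) < m) ⊎ (suc i % m ≡ 0 × suc (i % m) ≡ m)
      next i with m≤n⇒m<n∨m≡n (m%n<n i m)
      ... | inj₁ lt = inj₁ (trans (%-distribˡ-+ 1 i m) (m<n⇒m%n≡m lt) , lt)
      ... | inj₂ e = inj₂ (trans (%-distribˡ-+ 1 i m) (trans (cong (_% m) e) (n%n≡0 m)) , e)
      k-suc : ∀ i → k (suc i) ≡ at p (suc (i % m))
      k-suc i with next i
      ... | inj₁ (e , _) = cong (at p) e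
      ... | inj₂ (e , e′) = trans (cong (at p) e) (trans (start p) (trans (sym (end p)) (cong (at p) (sym e′))))
      ed : ∀ i → k i ~ k (suc i)
      ed i = subst (k i ~_) (sym (k-suc i)) (edge (isPath p) (i % m) (m%n<n i m))
      nonb : ∀ i → k i ≢ k (2 + i)
      nonb i e with next i
      ... | inj₁ (e′ , lt) = nb (isPath p) (i % m) lt
          (trans e (trans (k-suc (suc i)) (cong (λ t → at p (suc t)) e′)))
      ... | inj₂ (e′ , e″) = 1≢ (trans (cong (at p) (sym (suc-injective e″)))
          (trans e (trans (k-suc (suc i)) (cong (λ t → at p (suc t)) e′))))
      k≡ : ∀ i → i ≤ m → k i ≡ at p i
      k≡ i i≤m with m≤n⇒m<n∨m≡n i≤m
      ... | inj₁ lt = cong (at p) (m<n⇒m%n≡m lt)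
      ... | inj₂ refl = trans (cong (at p) (n%n≡0 m)) (trans (start p) (sym (end p)))

    -- Of the two walks between repeats, at least one differs in its first step from the given short
    -- walk and closes with it to a length of at most 2D - 2.
    R-far : ∀ {x y l} → R x y → Path x y l → 1 ≤ l → 2 + l ≤ D → ⊥
    R-far {l = suc l} Rxy p _ l≤ with R⇒two-paths Rxy
    ... | a , b , a<D , b<D , q , r , q≢r with first q Fin.≟ first p
    ... | no q≢p = no-closed (suc (suc a + l)) (s≤s z≤n)
            (≤-trans (≤-reflexive (sym (trans (+-suc (suc a) (2 + l))
                (cong suc (trans (+-suc (suc a) (suc l)) (cong suc (+-suc (suc a) l)))))))
                (+-mono-≤ a<D l≤)) (fork q p (λ _ → q≢p))
    ... | yes q≡p = no-closed (suc (suc b + l)) (s≤s z≤n)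
            (≤-trans (≤-reflexive (sym (trans (+-suc (suc b) (2 + l))
                (cong suc (trans (+-suc (suc b) (suc l)) (cong suc (+-suc (suc b) l)))))))
                (+-mono-≤ b<D l≤)) (fork r p (λ _ e → q≢r (trans q≡p (sym e))))

    -- Consequences of symmetry and commutation.

    module Commuting (δ-symm : ∀ x y → δ y (r₁ x) + δ y (r₂ x) ≡ δ x (r₁ y) + δ x (r₂ y))
      (A-comm : ∀ x z → A z (r₁ x) + A z (r₂ x) ≡ A x (r₁ z) + A x (r₂ z)) where

      -- {a , b} is the multiset of repeats of x
      Reps : V → V → V → Set
      Reps x a b = (r₁ x ≡ a × r₂ x ≡ b) ⊎ (r₁ x ≡ b × r₂ x ≡ a)

      Reps-swap : ∀ {x a b} → Reps x a b → Reps x b a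
      Reps-swap (inj₁ p) = inj₂ p
      Reps-swap (inj₂ p) = inj₁ p

      Reps⇒R : ∀ {x a b} → Reps x a b → R x a
      Reps⇒R (inj₁ (p , _)) = inj₁ (sym p)
      Reps⇒R (inj₂ (_ , p)) = inj₂ (sym p)

      Reps-R : ∀ {x a b c} → Reps x a b → R x c → (c ≡ a) ⊎ (c ≡ b)
      Reps-R (inj₁ (p , q)) (inj₁ e) = inj₁ (trans e p)
      Reps-R (inj₁ (p , q)) (inj₂ e) = inj₂ (trans e q)
      Reps-R (inj₂ (p , q)) (inj₁ e) = inj₂ (trans e p)
      Reps-R (inj₂ (p , q)) (inj₂ e) = inj₁ (trans e q)

      Reps-unique : ∀ {x a b c} → Reps x a b → Reps x a c → b ≡ c
      Reps-unique (inj₁ (refl , refl)) (inj₁ (_ , e)) = e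
      Reps-unique (inj₁ (refl , refl)) (inj₂ (e , e′)) = trans e′ e
      Reps-unique (inj₂ (refl , refl)) (inj₁ (e , e′)) = trans e e′
      Reps-unique (inj₂ (refl , refl)) (inj₂ (e , _)) = e

      R-sym : ∀ {x y} → R x y → R y x
      R-sym {x} {y} Rxy = δ+δ-pos (subst (1 ≤_) (δ-symm x y) (pos Rxy))
        where
        pos : R x y → 1 ≤ δ y (r₁ x) + δ y (r₂ x)
        pos (inj₁ e) = ≤-trans (≤-reflexive (sym (trans (cong (δ y) (sym e)) (δ-refl y)))) (m≤m+n _ _)
        pos (inj₂ e) = ≤-trans (≤-reflexive (sym (trans (cong (δ y) (sym e)) (δ-refl y)))) (m≤n+m _ _)

      two-R⇒Reps : ∀ {x a b} → R x a → R x b → a ≢ b → Reps x a b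
      two-R⇒Reps (inj₁ p) (inj₁ q) a≢b = ⊥-elim (a≢b (trans p (sym q)))
      two-R⇒Reps (inj₁ p) (inj₂ q) _ = inj₁ (sym p , sym q)
      two-R⇒Reps (inj₂ p) (inj₁ q) _ = inj₂ (sym q , sym p)
      two-R⇒Reps (inj₂ p) (inj₂ q) a≢b = ⊥-elim (a≢b (trans p (sym q)))

      -- Meaningful only if a is a repeat of x.
      other : V → V → V
      other x a with a Fin.≟ r₁ x
      ... | yes _ = r₂ x
      ... | no _ = r₁ x

      other-Reps : ∀ {x a} → R x a → Reps x a (other x a)
      other-Reps {x} {a} Rxa with a Fin.≟ r₁ x | Rxa
      ... | yes e | _ = inj₁ (sym e , refl)
      ... | no ¬e | inj₁ e = ⊥-elim (¬e e)
      ... | no _ | inj₂ e = inj₂ (refl , sym e)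

      R⇒Reps-sym : ∀ {x a} → R x a → Reps a x (other a x)
      R⇒Reps-sym Rxa = other-Reps (R-sym Rxa)

      -- `δ-symm` compares multiplicities, not only the relation `R`.
      double-sym : ∀ {x a} → Reps x a a → Reps a x x
      double-sym {x} {a} d = inj₁ (proj₁ r≡x , proj₂ r≡x)
        where
        r≡ : r₁ x ≡ a × r₂ x ≡ a
        r≡ = [ (λ p → p) , (λ p → p) ]′ d
        two : 2 ≤ δ x (r₁ a) + δ x (r₂ a)
        two = subst (2 ≤_) (δ-symm x a)
            (≤-reflexive (sym (cong₂ _+_ (trans (cong (δ a) (proj₁ r≡)) (δ-refl a))
            (trans (cong (δ a) (proj₂ r≡)) (δ-refl a)))))
        both : 2 ≤ δ x (r₁ a) + δ x (r₂ a) → r₁ a ≡ x × r₂ a ≡ x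
        both 2≤ with x Fin.≟ r₁ a | x Fin.≟ r₂ a
        both 2≤ | yes e | yes e′ = sym e , sym e′
        both (s≤s ()) | yes _ | no _
        both (s≤s ()) | no _ | yes _
        both () | no _ | no _
        r≡x = both two

      A-Reps : ∀ {x a b} z → Reps x a b → A z (r₁ x) + A z (r₂ x) ≡ A z a + A z b
      A-Reps z (inj₁ (refl , refl)) = refl
      A-Reps {x} z (inj₂ (refl , refl)) = +-comm (A z (r₁ x)) _

      -- Commutation, read for arbitrary names of the repeats. It is the source of all transfers of
      -- adjacency from a pair of vertices to their repeats.
      Reps-comm : ∀ {x a b z c d} → Reps x a b → Reps z c d → A z a + A z b ≡ A x c + A x d
      Reps-comm {x} {z = z} rx rz = trans (sym (A-Reps z rx)) (trans (A-comm x z) (A-Reps x rz))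

      one-adjacent : ∀ {x a b z c d} → Reps x a b → Reps z c d → x ~ c → z ~ a ⊎ z ~ b
      one-adjacent {x} {a} {b} {z} {c} {d} rx rz x~c with T? (adj G z a) | T? (adj G z b)
      ... | yes z~a | _ = inj₁ z~a
      ... | no _ | yes z~b = inj₂ z~b
      ... | no z≁a | no z≁b with trans (sym (cong₂ _+_ (≁⇒A≡0 z≁a) (≁⇒A≡0 z≁b)))
          (trans (Reps-comm rx rz) (cong (_+ A x d) (~⇒A≡1 x~c)))
      ... | ()

      other-adjacent : ∀ {x a b z c d} → Reps x a b → Reps z c d → x ~ c → z ≁ a → z ~ b
      other-adjacent rx rz x~c z≁a with one-adjacent rx rz x~c
      ... | inj₁ z~a = ⊥-elim (z≁a z~a)
      ... | inj₂ z~b = z~b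

      both-adjacent : ∀ {x a b z c d} → Reps x a b → Reps z c d → x ~ c → x ~ d → z ~ a × z ~ b
      both-adjacent {x} {a} {b} {z} rx rz x~c x~d = A-pos (lemma (A-≤1 z b) Σ≡2) , A-pos
          (lemma (A-≤1 z a) (trans (+-comm (A z b) _) Σ≡2))
        where
        Σ≡2 : A z a + A z b ≡ 2
        Σ≡2 = trans (Reps-comm rx rz) (cong₂ _+_ (~⇒A≡1 x~c) (~⇒A≡1 x~d))
        lemma : ∀ {s t} → t ≤ 1 → s + t ≡ 2 → 1 ≤ s
        lemma {zero} t≤1 refl with t≤1
        ... | s≤s ()
        lemma {suc s} _ _ = s≤s z≤n

      not-both-adjacent : ∀ {x a b z c d} → Reps x a b → Reps z c d → x ≁ d → z ~ a → z ≁ b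
      not-both-adjacent {x} {z = z} {c} rx rz x≁d z~a z~b with
        ≤-trans (≤-reflexive (trans (sym (cong₂ _+_ (~⇒A≡1 z~a) (~⇒A≡1 z~b)))
            (trans (Reps-comm rx rz) (trans (cong (A x c +_) (≁⇒A≡0 x≁d)) (+-identityʳ _))))) (A-≤1 x c)
      ... | s≤s ()

      no-closed-≤6 : ∀ {x} c → 1 ≤ c → c ≤ 6 → Path x x c → ⊥
      no-closed-≤6 c 1≤c c≤6 = no-closed c 1≤c (≤-trans (s≤s (s≤s c≤6)) (+-mono-≤ 4≤D 4≤D))

      no-triangle : ∀ {a b c} → a ~ b → b ~ c → c ~ a → ⊥
      no-triangle a~b b~c c~a = no-closed-≤6 3 (s≤s z≤n) (s≤s (s≤s (s≤s z≤n)))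
        (cons a~b (cons b~c (cons c~a empty (λ ())) (λ _ → ~⇒≢ (~-sym a~b))) (λ _ → ~⇒≢ (~-sym c~a)))

      common-nbr : ∀ {x y a b} → x ≢ y → x ~ a → a ~ y → x ~ b → b ~ y → a ≡ b
      common-nbr {a = a} {b} x≢y x~a a~y x~b b~y with a Fin.≟ b
      ... | yes a≡b = a≡b
      ... | no a≢b = ⊥-elim (no-closed-≤6 4 (s≤s z≤n) (s≤s (s≤s (s≤s (s≤s z≤n))))
          (cons x~a (cons a~y (cons (~-sym b~y) (cons (~-sym x~b) empty (λ ())) (λ _ → x≢y ∘ sym))
              (λ _ → a≢b)) (λ _ → x≢y)))

      no-hexagon : ∀ {a b c d e f} → a ~ b → b ~ c → c ~ d → d ~ e → e ~ f → f ~ a →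
                   a ≢ c → b ≢ d → c ≢ e → d ≢ f → e ≢ a → ⊥
      no-hexagon ab bc cd de ef fa ac bd ce df ea = no-closed-≤6 6 (s≤s z≤n) ≤-refl
        (cons ab (cons bc (cons cd (cons de (cons ef (cons fa empty (λ ())) (λ _ → ea)) (λ _ → df))
            (λ _ → ce)) (λ _ → bd)) (λ _ → ac))

      -- Antipodes on a cycle of length 2D, their other repeats, and crossings.

      opp : (ℕ → V) → ℕ → V
      opp k i = other (k (i + D)) (k i)

      Cross : (ℕ → V) → ℕ → Set
      Cross k i = opp k i ~ k (suc i) × opp k (suc i) ~ k i

      Cross? : ∀ k → Decidable (Cross k)
      Cross? k i = T? (adj G (opp k i) (k (suc i))) ×-dec T? (adj G (opp k (suc i)) (k i))

      cycle-R-D : ∀ {k} → Cycle (D + D) k → ∀ i → R (k i) (k (i + D))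
      cycle-R-D {k} K i = subst (λ j → R (k i) (k j)) (+-comm D i) (cycle-R K refl 1≤D ≤-refl 1≤D ≤-refl i)

      module _ {k : ℕ → V} (K : Cycle (D + D) k) where

        private
          m : ℕ → V
          m = opp k
          X : ℕ → Set
          X = Cross k

        per-D : ∀ i → k (i + D + D) ≡ k i
        per-D i = trans (cong k (+-assoc i D D)) (cyc-per K i)

        reps-opp : ∀ i → Reps (k (i + D)) (k i) (m i)
        reps-opp i = R⇒Reps-sym (cycle-R-D K i)

        reps-cyc : ∀ i → Reps (k i) (k (i + D)) (m (i + D))
        reps-cyc i = subst (λ v → Reps v (k (i + D)) (m (i + D))) (per-D i) (reps-opp (i + D))

        opp-per : ∀ i → m (i + (D + D)) ≡ m i
        opp-per i = cong₂ other (trans (cong k eq) (cyc-per K (i + D))) (cyc-per K i)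
          where
          eq : i + (D + D) + D ≡ i + D + (D + D)
          eq = trans (cong (_+ D) (sym (+-assoc i D D))) (+-assoc (i + D) D D)

        -- The antipodal edge from `k (i + D)` to `k (suc i + D)` makes `m i` adjacent to
        -- `k (suc i)` or `m (suc i)`, and `m (suc i)` adjacent to `k i` or `m i`. Without the link,
        -- both alternatives give a crossing.
        opp-link : ∀ i → ¬ X i → m i ~ m (suc i)
        opp-link i ¬Xi with T? (adj G (m i) (m (suc i)))
        ... | yes link = link
        ... | no ¬link = ⊥-elim (¬Xi
          ( other-adjacent (Reps-swap (reps-opp (suc i))) (R⇒Reps-sym (Reps⇒R (Reps-swap (reps-opp i))))
              (~-sym (cyc-edge K (i + D))) ¬link
          , other-adjacent (Reps-swap (reps-opp i)) (R⇒Reps-sym (Reps⇒R (Reps-swap (reps-opp (suc i)))))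
              (cyc-edge K (i + D)) (¬link ∘ ~-sym)))

        -- A crossing makes `k i` adjacent to both repeats of `k (suc i + D)`, hence `k (suc i + D)`
        -- adjacent to both repeats of `k i`; likewise with `i` and `suc i` exchanged.
        Cross-shift : ∀ i → X i → X (i + D)
        Cross-shift i (mi~ , ~mi) =
          ~-sym (proj₂ (both-adjacent (reps-cyc i) (reps-opp (suc i)) (cyc-edge K i) (~-sym ~mi))) ,
          ~-sym (proj₂ (both-adjacent (reps-cyc (suc i)) (reps-opp i) (~-sym (cyc-edge K i)) (~-sym mi~)))

        Cross-unshift : ∀ i → X (i + D) → X i
        Cross-unshift i Xi with Cross-shift (i + D) Xi
        ... | a , b = subst₂ _~_ (per-m i) (per-D (suc i)) a , subst₂ _~_ (per-m (suc i)) (per-D i) b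
          where
          per-m : ∀ i → m (i + D + D) ≡ m i
          per-m i = trans (cong m (+-assoc i D D)) (opp-per i)

        no-Cross : (∀ i → i < D → ¬ X i) → ∀ i → ¬ X i
        no-Cross none i = go (suc i) i ≤-refl
          where
          go : ∀ b i → i < b → ¬ X i
          go (suc b) i i<b Xi with i <? D
          ... | yes i<D = none i i<D Xi
          ... | no i≮D = go b (i ∸ D) (<-≤-trans (∸-monoʳ-< 1≤D (≮⇒≥ i≮D)) (s≤s⁻¹ i<b))
                           (Cross-unshift (i ∸ D) (subst X (sym (m∸n+n≡m (≮⇒≥ i≮D))) Xi))

        Single : ℕ → Set
        Single i = m i ≢ k i

        -- If `m (suc i)` were `k (suc i)`, the link from `m i` to it and the cycle edge would
        -- together be a crossing at `i`.
        Single-suc : ∀ i → ¬ X i → Single (suc i)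
        Single-suc i ¬Xi e = ¬Xi (subst (m i ~_) e (opp-link i ¬Xi) , subst (_~ k i) (sym e)
            (~-sym (cyc-edge K i)))

        -- A common value `z` has the repeats `a` and `b`, both adjacent to `x`, so `k (suc i)` is
        -- adjacent to `z`. Transferring this back, `x` and `m (suc i + D)` are both common
        -- neighbours of `a` and `b`, hence equal. Then `x` is a double repeat of `k (suc i)`,
        -- against singleness.
        opp-nb : ∀ i → Single (suc i) → m i ≢ m (2 + i)
        opp-nb i single e = single (Reps-unique (reps-opp (suc i))
            (double-sym (subst (Reps (k (suc i)) x) (sym x≡) (reps-cyc (suc i)))))
          where
          x = k (suc i + D)
          a = k (i + D)
          b = k (2 + i + D)
          z = m i
          rb : Reps b (k (2 + i)) z
          rb = subst (Reps b (k (2 + i))) (sym e) (reps-opp (2 + i))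
          rz : Reps z a b
          rz = two-R⇒Reps (R-sym (Reps⇒R (Reps-swap (reps-opp i)))) (R-sym (Reps⇒R (Reps-swap rb)))
              (cyc-nb K (i + D))
          k₁~z : k (suc i) ~ z
          k₁~z = ~-sym (proj₁ (both-adjacent (reps-opp (suc i)) rz (~-sym (cyc-edge K (i + D)))
              (cyc-edge K (suc i + D))))
          a~m : a ~ m (suc i + D)
          a~m = proj₂ (both-adjacent (reps-cyc (suc i)) (reps-opp i) (~-sym (cyc-edge K i)) k₁~z)
          b~m : b ~ m (suc i + D)
          b~m = proj₂ (both-adjacent (reps-cyc (suc i)) rb (cyc-edge K (suc i)) k₁~z)
          x≡ : x ≡ m (suc i + D)
          x≡ = common-nbr (cyc-nb K (i + D)) (cyc-edge K (i + D)) (cyc-edge K (suc i + D)) a~m (~-sym b~m)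

        -- Without crossings `m` is itself a cycle of length 2D, on which `m 0` and `m D` are
        -- antipodal.
        no-Cross⇒R : Single 0 → (∀ i → ¬ X i) → R (m 0) (m D)
        no-Cross⇒R single₀ none = cycle-R-D M 0
          where
          single : ∀ i → Single i
          single zero = single₀
          single (suc i) = Single-suc i (none i)
          M : Cycle (D + D) m
          M = record { cyc-edge = λ i → opp-link i (none i) ; cyc-nb = λ i → opp-nb i (single (suc i)) ;
              cyc-per = opp-per }

        -- `m i` is a repeat of `k (i + D)`, but `k (2 + i)` is only `D - 2` steps away from it.
        k≢opp : ∀ i → k (2 + i) ≢ m i
        k≢opp i e = R-far (R-sym (subst (R (k (i + D))) (sym e) (Reps⇒R (Reps-swap (reps-opp i)))))
          (castEnd (cong k (trans (sym (+-assoc (D ∸ 2) 2 i))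
              (trans (cong (_+ i) (m∸n+n≡m 2≤D)) (+-comm D i)))) (arc⁺ K (2 + i) (D ∸ 2)))
          (m<n⇒0<n∸m (≤-trans (s≤s (s≤s (s≤s z≤n))) 4≤D)) (≤-reflexive (m+[n∸m]≡n 2≤D))
          where
          2≤D : 2 ≤ D
          2≤D = ≤-trans (s≤s (s≤s z≤n)) 4≤D

        -- The path is `k 0`, ..., `k (suc i)`, `m i`, ..., `m 0`. The links among the `m j` come
        -- from the absence of earlier crossings, which also passes singleness on from 0.
        first-Cross-path : Single 0 → ∀ i → X i → (∀ j → j < i → ¬ X j) →
          ∃ λ (p : Path (k 0) (m 0) (2 + (i + i))) → first p ≡ k 1
        first-Cross-path single₀ i Xi none = record
          { at = glue (suc i) k (λ j → m (i ∸ j))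
          ; isPath = glue-isPath (suc i) i (isPath (arc⁰ (suc i))) (reverse-isPath mPath) (~-sym (proj₁ Xi))
              (λ { j refl → single i ≤-refl ∘ sym }) (λ 1≤i → joint i 1≤i)
          ; start = refl
          ; end = trans (glue-right (suc i) k (λ j → m (i ∸ j)) i) (cong m (n∸n≡0 i)) } , refl
          where
          single : ∀ j → j ≤ i → Single j
          single zero _ = single₀
          single (suc j) j<i = Single-suc j (none j j<i)
          arc⁰ : ∀ l → Path (k 0) (k l) l
          arc⁰ l = record { at = k ; isPath = record { edge = λ j _ → cyc-edge K j ; nb = λ j _ → cyc-nb K j
              } ; start = refl ; end = refl }
          mPath : IsPath m i
          mPath = record { edge = λ j j<i → opp-link j (none j j<i) ; nb = λ j j≤i → opp-nb j
              (single (suc j) (≤-trans (n≤1+n _) j≤i)) }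
          joint : ∀ i → 1 ≤ i → k (suc i) ≢ m (i ∸ 1)
          joint (suc i) _ = k≢opp i

      -- Reversed cycles, and detours through the nearest crossing.

      -- k backwards, since -1 ≡ 2D - 1 modulo the period
      rev : (ℕ → V) → ℕ → V
      rev k j = k (j * pred (D + D))

      private
        D+D≡ : suc (pred (D + D)) ≡ D + D
        D+D≡ = suc-pred (D + D) {{>-nonZero (≤-trans 1≤D (m≤m+n D D))}}

      module _ {k : ℕ → V} (K : Cycle (D + D) k) where

        per-* : ∀ i t → k (i + t * (D + D)) ≡ k i
        per-* i zero = cong k (+-identityʳ i)
        per-* i (suc t) = trans (cong k (trans (cong (i +_) (+-comm (D + D) _)) (sym (+-assoc i _ _))))
            (trans (cyc-per K (i + t * (D + D))) (per-* i t))

        rev-at : ∀ {i j} → i + j ≡ D + D → rev k j ≡ k i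
        rev-at {i} {j} eq = trans (sym (cyc-per K _)) (trans (cong k index) (per-* i j))
          where
          open ≡-Reasoning
          c = pred (D + D)
          index : j * c + (D + D) ≡ i + j * (D + D)
          index = begin
            j * c + (D + D)     ≡⟨ +-comm (j * c) _ ⟩
            D + D + j * c       ≡⟨ cong (_+ j * c) (sym eq) ⟩
            i + j + j * c       ≡⟨ +-assoc i j _ ⟩
            i + (j + j * c)     ≡⟨ cong (i +_) (sym (*-suc j c)) ⟩
            i + j * suc c       ≡⟨ cong (λ t → i + j * t) D+D≡ ⟩
            i + j * (D + D)     ∎

        rev-Cycle : Cycle (D + D) (rev k)
        rev-Cycle = record
          { cyc-edge = λ j → ~-sym (subst (λ v → k (c + j * c) ~ v) (wrap (j * c)) (cyc-edge K (c + j * c)))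
          ; cyc-nb = λ j e → cyc-nb K (c + (c + j * c))
              (trans (sym e) (sym (trans (cong k (sym (cong suc (+-suc c (c + j * c)))))
              (trans (wrap (suc (c + j * c))) (wrap (j * c))))))
          ; cyc-per = λ j → trans (cong k
              (trans (*-distribʳ-+ c j (D + D)) (cong (j * c +_) (*-comm (D + D) c)))) (per-* (j * c) c) }
          where
          c = pred (D + D)
          wrap : ∀ i → k (suc (c + i)) ≡ k i
          wrap i = trans (cong k (trans (cong (_+ i) D+D≡) (+-comm (D + D) i))) (cyc-per K i)

        rev-opp : ∀ {i j} → i + D + j ≡ D + D → i + (j + D) ≡ D + D → opp (rev k) j ≡ opp k (i + D)
        rev-opp {i} {j} e₁ e₂ = cong₂ other (trans (rev-at e₂) (sym (per-D K i))) (rev-at e₁)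

        -- The edge of the reversed cycle at `j` is the antipode of the edge at `i`, so
        -- `Cross-shift` applies.
        rev-Cross : ∀ i j → suc (i + j) ≡ D → Cross k i → Cross (rev k) j
        rev-Cross i j eq Xi with Cross-shift K i Xi
        ... | a , b = subst₂ _~_ (sym (rev-opp {suc i} {j} e₁ e₂)) (sym (rev-at {i + D} {suc j} e₃)) b
                    , subst₂ _~_ (sym (rev-opp {i} {suc j} e₃ e₄)) (sym (rev-at {suc i + D} {j} e₁)) a
          where
          open +-*-Solver
          lemma : ∀ {a} → a ≡ suc (i + j) + D → a ≡ D + D
          lemma e = trans e (cong (_+ D) eq)
          e₁ : suc i + D + j ≡ D + D
          e₁ = lemma (solve 3 (λ i j d → con 1 :+ i :+ d :+ j := con 1 :+ (i :+ j) :+ d) refl i j D)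
          e₂ : suc i + (j + D) ≡ D + D
          e₂ = lemma (solve 3 (λ i j d → con 1 :+ i :+ (j :+ d) := con 1 :+ (i :+ j) :+ d) refl i j D)
          e₃ : i + D + suc j ≡ D + D
          e₃ = lemma (solve 3 (λ i j d → i :+ d :+ (con 1 :+ j) := con 1 :+ (i :+ j) :+ d) refl i j D)
          e₄ : i + (suc j + D) ≡ D + D
          e₄ = lemma (solve 3 (λ i j d → i :+ (con 1 :+ j :+ d) := con 1 :+ (i :+ j) :+ d) refl i j D)

      -- The path runs along the cycle from x to the nearest crossing and back to z along the repeats of antipodes.
      record Detour (x y z : V) : Set where
        field
          cyc      : ℕ → V
          isCycle  : Cycle (D + D) cyc
          cyc-0    : cyc 0 ≡ x
          cyc-D    : cyc D ≡ y
          half     : ℕ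
          half<    : suc (half + half) ≤ D
          path     : Path x z (2 + (half + half))
          path-1   : first path ≡ cyc 1

      near-Cross⇒Detour : ∀ {k x y z} → Cycle (D + D) k → k 0 ≡ x → k D ≡ y → opp k 0 ≡ z → opp k 0 ≢ k 0 →
                          ∀ i → suc (i + i) ≤ D → Cross k i → Detour x y z
      near-Cross⇒Detour {k} K refl refl refl single₀ i i≤ Xi with least (Cross? k) i Xi
      ... | h , h≤i , Xh , minimal with first-Cross-path K single₀ h Xh minimal
      ... | p , p₁ = record
        { cyc = k ; isCycle = K ; cyc-0 = refl ; cyc-D = refl ; half = h
        ; half< = ≤-trans (s≤s (+-mono-≤ h≤i h≤i)) i≤ ; path = p ; path-1 = p₁ }

      -- Some crossing lies at an index `i` below `D`, and on the reversed cycle at `D - 1 - i`. The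
      -- smaller of the two indices is at most half of `D - 1`.
      detour : ∀ {k} → Cycle (D + D) k → opp k 0 ≢ k 0 → ¬ R (opp k 0) (opp k D) → Detour (k 0) (k D) (opp k 0)
      detour {k} K single₀ ¬R with anyUpTo? (Cross? k) D
      ... | no none = ⊥-elim (¬R (no-Cross⇒R K single₀ (no-Cross K (λ i i<D Xi → none (i , i<D , Xi)))))
      ... | yes (i , i<D , Xi) with suc (i + i) ≤? D
      ...   | yes i≤ = near-Cross⇒Detour K refl refl refl single₀ i i≤ Xi
      ...   | no i≰ = near-Cross⇒Detour (rev-Cycle K) refl (rev-at K {D} {D} refl) opp≡
          (single₀ ∘ trans (sym opp≡)) j j≤ (rev-Cross K i j i+j Xi)
        where
        opp≡ : opp (rev k) 0 ≡ opp k 0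
        opp≡ = cong (λ v → other v (k 0)) (rev-at K {D} {D} refl)
        j = D ∸ suc i
        i+j : suc (i + j) ≡ D
        i+j = m+[n∸m]≡n i<D
        open +-*-Solver
        j≤ : suc (j + j) ≤ D
        j≤ = <⇒≤ (+-cancelʳ-< (i + i) _ _ (<-≤-trans
          (≤-<-trans (≤-reflexive (trans (solve 2 (λ i j → con 1 :+ (j :+ j) :+ (i :+ i) := con 1 :+
              (i :+ j) :+ (i :+ j)) refl i j) (cong (_+ (i + j)) i+j)))
            (+-monoʳ-< D (≤-reflexive i+j)))
          (+-monoʳ-≤ D (s≤s⁻¹ (≰⇒> i≰)))))

      -- Excluding cycles of length 2D - 1 and crossings.

      module Exclusion (fresh-nbr : ∀ u a b c → ∃ λ w → u ~ w × w ≢ a × w ≢ b × w ≢ c) where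

        E : ℕ
        E = D ∸ 1

        sucE : suc E ≡ D
        sucE = m+[n∸m]≡n 1≤D

        1≤E : 1 ≤ E
        1≤E = s≤s⁻¹ (subst (2 ≤_) (sym sucE) (≤-trans (s≤s (s≤s z≤n)) 4≤D))

        E≤D : E ≤ D
        E≤D = m∸n≤m D 1

        -- For a neighbour w of u₀, where u₀ and u₂ are the repeats of v₁.
        record Parallel (v₁ u₂ w : V) : Set where
          field
            w₁ w₋₁ w₂ : V
            reps-w    : Reps w w₁ w₋₁
            reps-w₁   : Reps w₁ w w₂
            v₁~w₁     : v₁ ~ w₁
            v₁≁w₋₁    : v₁ ≁ w₋₁
            u₂~w₂     : u₂ ~ w₂

        -- Adjacency is carried along the chain of repeats `u₀`, `v₁`, `u₂`. As `w` is adjacent to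
        -- just one repeat of `v₁`, exactly one repeat of `w` is adjacent to `v₁`, and its other
        -- repeat is adjacent to `u₂`.
        parallel : ∀ {v₁ u₀ u₂ w} → Reps v₁ u₀ u₂ → w ~ u₀ → w ≁ u₂ → Parallel v₁ u₂ w
        parallel {v₁} {u₀} {u₂} {w} rv₁ w~u₀ w≁u₂ = pick (one-adjacent rw rv₁ w~u₀)
          where
          rw : Reps w (r₁ w) (r₂ w)
          rw = inj₁ (refl , refl)
          build : ∀ {w₁ w₋₁} → Reps w w₁ w₋₁ → v₁ ~ w₁ → Parallel v₁ u₂ w
          build {w₁} {w₋₁} rw v₁~w₁ = record
            { w₁ = w₁ ; w₋₁ = w₋₁ ; w₂ = other w₁ w ; reps-w = rw ; reps-w₁ = rw₁ ; v₁~w₁ = v₁~w₁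
            ; v₁≁w₋₁ = not-both-adjacent rw rv₁ w≁u₂ v₁~w₁
            ; u₂~w₂ = other-adjacent rw₁ (R⇒Reps-sym (Reps⇒R (Reps-swap rv₁))) (~-sym v₁~w₁) (w≁u₂ ∘ ~-sym) }
            where rw₁ = R⇒Reps-sym (Reps⇒R rw)
          pick : v₁ ~ r₁ w ⊎ v₁ ~ r₂ w → Parallel v₁ u₂ w
          pick (inj₁ v₁~) = build rw v₁~
          pick (inj₂ v₁~) = build (Reps-swap rw) v₁~

        module ParallelProperties {v₁ u₀ u₂ w} (rv₁ : Reps v₁ u₀ u₂) (w~u₀ : w ~ u₀) (w≁u₂ : w ≁ u₂)
                                  (Par : Parallel v₁ u₂ w) where
          open Parallel Par

          w₂≢w : w₂ ≢ w
          w₂≢w e = w≁u₂ (~-sym (subst (u₂ ~_) e u₂~w₂))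

          w₋₁~v₋₁ : ∀ {v₋₁} → Reps u₀ v₁ v₋₁ → w₋₁ ~ v₋₁
          w₋₁~v₋₁ ru₀ = other-adjacent ru₀ (R⇒Reps-sym (Reps⇒R (Reps-swap reps-w))) (~-sym w~u₀)
              (v₁≁w₋₁ ∘ ~-sym)

          -- If the repeats closed up into a 4-cycle, `w₋₁` would also be the successor of `w₂` in
          -- the chain, alongside `v₃` as the successor of `u₂`.
          w₋₁~v₃ : ∀ {v₃} → Reps u₂ v₁ v₃ → R w₂ w₋₁ → w₋₁ ~ v₃
          w₋₁~v₃ ru₂ Rw₂w₋₁ = other-adjacent ru₂ rw₋₁ u₂~w₂ (v₁≁w₋₁ ∘ ~-sym)
            where
            rw₋₁ : Reps w₋₁ w₂ w
            rw₋₁ = two-R⇒Reps (R-sym Rw₂w₋₁) (R-sym (Reps⇒R (Reps-swap reps-w))) w₂≢w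

          detour-w : ∀ {k} → Cycle (D + D) k → k 0 ≡ w → k D ≡ w₁ → ¬ R w₂ w₋₁ → Detour w w₁ w₂
          detour-w {k} K refl refl ¬R = subst (Detour (k 0) (k D)) m₀≡
            (detour K (λ e → w₂≢w (trans (sym m₀≡) e)) (λ r → ¬R (subst₂ R m₀≡ m-D≡ r)))
            where
            m₀≡ : opp k 0 ≡ w₂
            m₀≡ = Reps-unique (reps-opp K 0) reps-w₁
            m-D≡ : opp k D ≡ w₋₁
            m-D≡ = Reps-unique (reps-cyc K 0) reps-w

        -- Two walks with different first steps close up, and the girth leaves only the lengths 2D
        -- and 2D - 1. At length 2D both walks have length `D`, which puts `y` at index `D`.
        R⇒Cycle : ∀ {x y} → R x y →
          (∃ λ k → Cycle (D + D) k × k 0 ≡ x × k D ≡ y) ⊎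
          (∃₂ λ c k → suc c ≡ D + D × Cycle c k × k 0 ≡ x)
        R⇒Cycle {x} {y} Rxy with R⇒two-paths (R-sym Rxy)
        ... | a , b , a<D , b<D , p , q , p≢q = byLength (m≤n⇒m<n∨m≡n c≤)
          where
          c = suc (suc a + b)
          c≤ : c ≤ D + D
          c≤ = ≤-trans (≤-reflexive (sym (+-suc (suc a) b))) (+-mono-≤ a<D b<D)
          l : Path x x c
          l = fork p q (λ _ → p≢q)
          3≤c : 3 ≤ c
          3≤c = ≮⇒≥ (λ c<3 → no-closed c (s≤s z≤n) (≤-trans (s≤s c<3) (≤-trans 4≤D (m≤m+n D D))) l)
          cyc = closed⇒Cycle 3≤c c≤ l
          k = proj₁ cyc
          k≡ = proj₂ (proj₂ cyc)
          k0≡ : k 0 ≡ x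
          k0≡ = trans (k≡ 0 z≤n) (start l)
          byLength : c < D + D ⊎ c ≡ D + D → _
          byLength (inj₁ c<) with m≤n⇒m<n∨m≡n c<
          ... | inj₁ c+2≤ = ⊥-elim (no-closed c (s≤s z≤n) c+2≤ l)
          ... | inj₂ c≡ = inj₂ (c , k , c≡ , proj₁ (proj₂ cyc) , k0≡)
          byLength (inj₂ c≡) = inj₁ (k , subst (λ c → Cycle c k) c≡ (proj₁ (proj₂ cyc)) , k0≡ , (begin
            k D                    ≡⟨ cong k (sym a≡) ⟩
            k (suc a)              ≡⟨ k≡ (suc a) (≤-trans (m≤m+n (suc a) b) (n≤1+n _)) ⟩
            at l (suc a)           ≡⟨ fork-left p q (λ _ → p≢q) (suc a) ≤-refl ⟩
            at p (suc a ∸ suc a)   ≡⟨ cong (at p) (n∸n≡0 (suc a)) ⟩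
            at p 0                 ≡⟨ start p ⟩
            y                      ∎))
            where
            open ≡-Reasoning
            a≡ : suc a ≡ D
            a≡ = ≤-antisym a<D (≮⇒≥ (λ sa<D → <⇒≢ (≤-<-trans (≤-reflexive (sym (+-suc (suc a) b)))
                (+-mono-<-≤ sa<D b<D)) c≡))

        -- Cycles of length 2D - 1

        module OddCycle {c k} (suc-c : suc c ≡ D + D) (K : Cycle c k) where

          D+E : D + E ≡ c
          D+E = suc-injective (trans (sym (+-suc D E)) (trans (cong (D +_) sucE) (sym suc-c)))

          E+D : E + D ≡ c
          E+D = trans (+-comm E D) D+E

          1≤c : 1 ≤ c
          1≤c = subst (1 ≤_) D+E (≤-trans 1≤D (m≤m+n D E))

          -- These are the two vertices farthest from `k i` on the cycle. They are consecutive,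
          -- hence distinct, and exhaust the repeats.
          reps-odd : ∀ i → Reps (k i) (k (D + i)) (k (E + i))
          reps-odd i = two-R⇒Reps (cycle-R K D+E 1≤D ≤-refl 1≤E E≤D i) (cycle-R K E+D 1≤E E≤D 1≤D ≤-refl i)
            (λ e → ~⇒≢ (cyc-edge K (E + i)) (trans (sym e) (cong k (cong (_+ i) (sym sucE)))))

          reps-odd-~ : ∀ i → k (E + i) ~ k (D + i)
          reps-odd-~ i = subst (λ j → k (E + i) ~ k (j + i)) sucE (cyc-edge K (E + i))

          reps-odd-adjacent : ∀ {a b} i → Reps (k i) a b → a ~ b
          reps-odd-adjacent {a} {b} i r with Reps-R (reps-odd i) (Reps⇒R r)
          ... | inj₁ refl = subst (k (D + i) ~_) (Reps-unique (reps-odd i) r) (~-sym (reps-odd-~ i))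
          ... | inj₂ refl = subst (k (E + i) ~_) (Reps-unique (Reps-swap (reps-odd i)) r) (reps-odd-~ i)

          -- The two arcs of the cycle already lead to `y`. A third walk would make `y` a double
          -- repeat, whereas the repeats of `k i` are adjacent to each other.
          no-third-path : ∀ {y l} i → R (k i) y → (p : Path (k i) y l) → 1 ≤ l → l ≤ D →
                          first p ≢ k (suc i) → first p ≢ prev c k i → ⊥
          no-third-path {y} {l} i Ry p 1≤l l≤D p≢next p≢prev =
            ~⇒≢ (reps-odd-adjacent i (inj₁ (refl , refl))) (trans (proj₁ r≡) (sym (proj₂ r≡)))
            where
            three : ∀ {a b} → a + b ≡ c → 1 ≤ a → a ≤ D → 1 ≤ b → b ≤ D → y ≡ k (a + i) → r₁ (k i) ≡ y × r₂
                (k i) ≡ y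
            three {a} {suc b} eq 1≤a a≤D 1≤b b≤D refl = three-paths⇒double p (arc⁺ K i a)
                (arc⁻ K i (suc b) a eq′) 1≤l l≤D 1≤a a≤D 1≤b b≤D
              p≢next (λ e → p≢prev (trans e (first-arc⁻ K i b a eq′)))
              (λ e → prev≢next K 1≤c i (trans e (first-arc⁻ K i b a eq′)))
              where eq′ = trans (+-comm (suc b) a) eq
            r≡ : r₁ (k i) ≡ y × r₂ (k i) ≡ y
            r≡ with Reps-R (reps-odd i) Ry
            ... | inj₁ e = three D+E 1≤D ≤-refl 1≤E E≤D e
            ... | inj₂ e = three E+D 1≤E E≤D 1≤D ≤-refl e

        cycle-back : ∀ {k} → Cycle (D + D) k → ∀ i → Path (k (suc i)) (k (D + suc i)) D
        cycle-back K i = arc⁻ K (suc i) D D refl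

        first-cycle-back : ∀ {k} (K : Cycle (D + D) k) i → first (cycle-back K i) ≡ k i
        first-cycle-back {k} K i = trans (cong k index) (cyc-per K i)
          where
          open ≡-Reasoning
          index : D ∸ 1 + (D + suc i) ≡ i + (D + D)
          index = begin
            E + (D + suc i)      ≡⟨ cong (E +_) (+-suc D i) ⟩
            E + suc (D + i)      ≡⟨ +-suc E _ ⟩
            suc E + (D + i)      ≡⟨ cong (_+ (D + i)) sucE ⟩
            D + (D + i)          ≡⟨ +-assoc D D i ⟨
            D + D + i            ≡⟨ +-comm (D + D) i ⟩
            i + (D + D)          ∎

        -- `u₀` and `u₂` are consecutive on the cycle and share the repeat `v₁`; `v₋₁`, `v₁`, `v₃`
        -- are consecutive too. The last hypothesis keeps `w` from being a repeat of `v₋₁`.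
        module OddEscape {c k} (suc-c : suc c ≡ D + D) (K : Cycle c k) {w} (u₀~w : k 0 ~ w) (w≢u₂ : w ≢ k 1)
                         (w≢prev : w ≢ prev c k 0) (w≢o : w ≢ other (k (E + 0)) (k 0)) where
          open OddCycle suc-c K
          u₀ u₂ v₁ v₋₁ v₃ : V
          u₀ = k 0
          u₂ = k 1
          v₁ = k (D + 0)
          v₋₁ = k (E + 0)
          v₃ = k (D + 1)
          ru₀ : Reps u₀ v₁ v₋₁
          ru₀ = reps-odd 0
          ru₂ : Reps u₂ v₁ v₃
          ru₂ = Reps-swap (subst (Reps u₂ v₃) (cong k (trans (+-suc E 0) (cong (_+ 0) sucE))) (reps-odd 1))
          u₀~u₂ : u₀ ~ u₂
          u₀~u₂ = cyc-edge K 0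
          rv₁ : Reps v₁ u₀ u₂
          rv₁ = two-R⇒Reps (R-sym (Reps⇒R ru₀)) (R-sym (Reps⇒R ru₂)) (~⇒≢ u₀~u₂)
          w~u₀ : w ~ u₀
          w~u₀ = ~-sym u₀~w
          w≁u₂ : w ≁ u₂
          w≁u₂ w~u₂ = no-triangle w~u₂ (~-sym u₀~u₂) u₀~w
          w≢u₀ : w ≢ u₀
          w≢u₀ = ~⇒≢ w~u₀
          ¬Rwv₁ : ¬ R w v₁
          ¬Rwv₁ r = [ w≢u₀ , w≢u₂ ]′ (Reps-R rv₁ (R-sym r))
          ¬Rwv₋₁ : ¬ R w v₋₁
          ¬Rwv₋₁ r = [ w≢u₀ , w≢o ]′ (Reps-R (R⇒Reps-sym (Reps⇒R (Reps-swap ru₀))) (R-sym r))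
          v₋₁~v₁ : v₋₁ ~ v₁
          v₋₁~v₁ = reps-odd-~ 0
          v₁~v₃ : v₁ ~ v₃
          v₁~v₃ = subst (λ j → v₁ ~ k j) (sym (+-suc D 0)) (cyc-edge K (D + 0))
          v₋₁≢v₃ : v₋₁ ≢ v₃
          v₋₁≢v₃ e = cyc-nb K (E + 0) (trans e (cong k (trans (+-suc D 0) (cong suc (cong (_+ 0) (sym sucE))))))

          module _ (Par : Parallel v₁ u₂ w) where
            open Parallel Par
            open ParallelProperties rv₁ w~u₀ w≁u₂ Par

            w₋₁≢v₁ : w₋₁ ≢ v₁
            w₋₁≢v₁ e = ¬Rwv₁ (subst (R w) e (Reps⇒R (Reps-swap reps-w)))

            -- Otherwise `w₁` and `v₋₁` are both common neighbours of `v₁` and `w₋₁`, hence equal,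
            -- and `w` is a repeat of `v₋₁`. As repeats on a cycle of length 2D - 1 are adjacent,
            -- `w` lies on no such cycle.
            w₁≁w₋₁ : w₁ ≁ w₋₁
            w₁≁w₋₁ w₁~w₋₁ = ¬Rwv₋₁ (subst (R w) (common-nbr (w₋₁≢v₁ ∘ sym) v₁~w₁ w₁~w₋₁ (~-sym v₋₁~v₁)
                (~-sym (w₋₁~v₋₁ ru₀))) (Reps⇒R reps-w))

            -- Otherwise `w₋₁` is, like `v₁`, a common neighbour of `v₋₁` and `v₃`.
            ¬R-w₂-w₋₁ : ¬ R w₂ w₋₁
            ¬R-w₂-w₋₁ r = w₋₁≢v₁ (common-nbr v₋₁≢v₃ (~-sym (w₋₁~v₋₁ ru₀)) (w₋₁~v₃ ru₂ r) v₋₁~v₁ v₁~v₃)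

            not-on-odd : ∀ {c′ k′} → suc c′ ≡ D + D → Cycle c′ k′ → ∀ i → k′ i ≢ w
            not-on-odd suc-c′ K′ i e = w₁≁w₋₁ (OddCycle.reps-odd-adjacent suc-c′ K′ i
                (subst (λ v → Reps v w₁ w₋₁) (sym e) reps-w))

            escape-detour : Detour w w₁ w₂
            escape-detour = pick (R⇒Cycle (Reps⇒R reps-w))
              where
              pick : _ ⊎ _ → Detour w w₁ w₂
              pick (inj₁ (k′ , K′ , e₀ , e-D)) = detour-w K′ e₀ e-D ¬R-w₂-w₋₁
              pick (inj₂ (c′ , k′ , suc-c′ , K′ , e)) = ⊥-elim (not-on-odd suc-c′ K′ 0 e)

            u₀≢w₂ : u₀ ≢ w₂
            u₀≢w₂ e = [ (λ e′ → ~⇒≢ v₁~w₁ (sym e′)) , (λ e′ → ¬Rwv₋₁ (subst (R w) e′ (Reps⇒R reps-w))) ]′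
              (Reps-R ru₀ (R-sym (subst (R w₁) (sym e) (Reps⇒R (Reps-swap reps-w₁)))))

            q : Path w w₂ 3
            q = cons w~u₀ (cons u₀~u₂ (cons (u₂~w₂) empty (λ ())) (λ _ → u₀≢w₂)) (λ _ → w≢u₂)

            -- From `u₀` back through `w`, the cycle `k′` would supply a third walk to a repeat of
            -- `u₀`.
            no-u₀-on-detour : ∀ {k′} → Cycle (D + D) k′ → k′ 0 ≡ w → k′ 1 ≢ u₀
            no-u₀-on-detour {k′} K′ e₀ e₁ = no-third-path 0
                (subst (λ x → R x (k′ (D + 1))) e₁ (cycle-R K′ refl 1≤D ≤-refl 1≤D ≤-refl 1))
              (castStart e₁ (cycle-back K′ 0)) 1≤D ≤-refl
              (λ e → w≢u₂ (trans (sym first≡w) e)) (λ e → w≢prev (trans (sym first≡w) e))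
              where
              first≡w : first (cycle-back K′ 0) ≡ w
              first≡w = trans (first-cycle-back K′ 0) e₀

            -- Together with `q` the path closes to length 2h + 5, which is odd and at most 2D. By
            -- the girth it is 2D - 1, but `w` lies on no cycle of that length.
            closing : ∀ h → suc (h + h) ≤ D → (p : Path w w₂ (2 + (h + h))) → first p ≢ u₀ → ⊥
            closing h h< p p≢u₀ = byLength (m≤n⇒m<n∨m≡n len≤)
              where
              a = 2 + (h + h)
              len = suc (a + 2)
              l : Path w₂ w₂ len
              l = fork p q (λ _ → p≢u₀)
              open +-*-Solver
              len≡ : len ≡ suc (h + h) + 4
              len≡ = solve 1 (λ h → con 1 :+ (con 2 :+ (h :+ h) :+ con 2) := con 1 :+ (h :+ h) :+ con 4) refl h
              len≤ : len ≤ D + D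
              len≤ = ≤-trans (≤-reflexive len≡) (+-mono-≤ h< 4≤D)
              len-odd : len ≢ D + D
              len-odd e = double≢odd D (h + 2)
                  (trans (sym e) (solve 1 (λ h → con 1 :+ (con 2 :+ (h :+ h) :+ con 2) := con 1 :+
                  (h :+ con 2 :+ (h :+ con 2))) refl h))
              on-odd : suc len ≡ D + D → (∃ λ k′ → Cycle len k′ × (∀ i → i ≤ len → k′ i ≡ at l i)) → ⊥
              on-odd suc-len (k′ , K′ , k′≡) = not-on-odd suc-len K′ a
                  (trans (k′≡ a (≤-trans (m≤m+n a 2) (n≤1+n _)))
                (trans (fork-left p q (λ _ → p≢u₀) a ≤-refl) (trans (cong (at p) (n∸n≡0 a)) (start p))))
              byLength′ : suc len < D + D ⊎ suc len ≡ D + D → ⊥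
              byLength′ (inj₁ len+2≤) = no-closed len (s≤s z≤n) len+2≤ l
              byLength′ (inj₂ suc-len) = on-odd suc-len (closed⇒Cycle (s≤s (s≤s (s≤s z≤n))) len≤ l)
              byLength : len < D + D ⊎ len ≡ D + D → ⊥
              byLength (inj₂ e) = len-odd e
              byLength (inj₁ len<) = byLength′ (m≤n⇒m<n∨m≡n len<)

            escape-absurd : Detour w w₁ w₂ → ⊥
            escape-absurd Δ = closing half half< path (λ e → no-u₀-on-detour isCycle cyc-0
                (trans (sym path-1) e))
              where open Detour Δ

        no-odd-cycle : ∀ {c k} → suc c ≡ D + D → Cycle c k → ⊥
        no-odd-cycle {c} {k} suc-c K with fresh-nbr (k 0) (k 1) (prev c k 0) (other (k (E + 0)) (k 0))
        ... | w , u₀~w , w≢u₂ , w≢prev , w≢o = escape-absurd Par (escape-detour Par)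
          where
          open OddEscape suc-c K u₀~w w≢u₂ w≢prev w≢o
          Par = parallel rv₁ w~u₀ w≁u₂

        -- Crossings

        R⇒even-Cycle : ∀ {x y} → R x y → ∃ λ k → Cycle (D + D) k × k 0 ≡ x × k D ≡ y
        R⇒even-Cycle Rxy = [ (λ even → even) ,
            (λ { (c , k , suc-c , K , _) → ⊥-elim (no-odd-cycle suc-c K) }) ]′ (R⇒Cycle Rxy)

        closed⇒even-Cycle : ∀ {x c} → 1 ≤ c → c ≤ D + D → (p : Path x x c) →
                            c ≡ D + D × (∃ λ k → Cycle c k × (∀ i → i ≤ c → k i ≡ at p i))
        closed⇒even-Cycle {x} {c} 1≤c c≤ p = byLength (m≤n⇒m<n∨m≡n c≤)
          where
          3≤c : 3 ≤ c
          3≤c = ≮⇒≥ (λ c<3 → no-closed c 1≤c (≤-trans (s≤s c<3) (≤-trans 4≤D (m≤m+n D D))) p)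
          cyc = closed⇒Cycle 3≤c c≤ p
          byLength′ : suc c < D + D ⊎ suc c ≡ D + D → ⊥
          byLength′ (inj₁ lt) = no-closed c 1≤c lt p
          byLength′ (inj₂ eq) = no-odd-cycle eq (proj₁ (proj₂ cyc))
          byLength : c < D + D ⊎ c ≡ D + D → c ≡ D + D × (∃ λ k → Cycle c k × (∀ i → i ≤ c → k i ≡ at p i))
          byLength (inj₁ lt) = ⊥-elim (byLength′ (m≤n⇒m<n∨m≡n lt))
          byLength (inj₂ eq) = eq , cyc

        record Antipodes {x y a} (p : Path x y D) (q : Path x y (suc a)) : Set where
          field
            length≡D   : suc a ≡ D
            antipodal  : R (first p) (at q E)
            last-steps : at p E ≢ at q E

        -- The walks close up to a cycle, which must have length 2D. On it, the first step of `p`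
        -- and the last vertex of `q` before `y` are `D` apart.
        antipodes : ∀ {x y a} (p : Path x y D) (q : Path x y (suc a)) → a < D → first p ≢ first q →
            Antipodes p q
        antipodes {x} {y} {a} p q a<D p≢q = build (closed⇒even-Cycle (s≤s z≤n) len≤ l)
          where
          len = suc (D + a)
          l : Path y y len
          l = fork p q (λ _ → p≢q)
          len≤ : len ≤ D + D
          len≤ = ≤-trans (≤-reflexive (sym (+-suc D a))) (+-monoʳ-≤ D a<D)
          build : len ≡ D + D × (∃ λ k → Cycle len k × (∀ i → i ≤ len → k i ≡ at l i)) → Antipodes p q
          build (len≡ , k , K , k≡) = record { length≡D = suc-a≡D ; antipodal = subst₂ R k-E k-D+E
              (cycle-R K′ refl 1≤D ≤-refl 1≤D ≤-refl E) ; last-steps = λ e → prev≢next K′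
              (≤-trans 1≤D (m≤m+n D D)) 0
                      (trans k-1 (trans e (trans (sym k-D+E) (cong k prev≡)))) }
            where
            K′ : Cycle (D + D) k
            K′ = subst (λ c → Cycle c k) len≡ K
            suc-a≡D : suc a ≡ D
            suc-a≡D = +-cancelˡ-≡ D _ _ (trans (+-suc D a) len≡)
            left : ∀ i → i ≤ D → k i ≡ at p (D ∸ i)
            left i i≤D = trans (k≡ i (≤-trans i≤D (≤-trans (m≤m+n D a) (n≤1+n _))))
                (fork-left p q (λ _ → p≢q) i i≤D)
            k-E : k E ≡ first p
            k-E = trans (left E E≤D) (cong (at p) (m∸[m∸n]≡n 1≤D))
            k-1 : k 1 ≡ at p E
            k-1 = left 1 1≤D
            prev≡ : D + E ≡ pred (D + D) + 0
            prev≡ = trans (cong pred (trans (sym (+-suc D E)) (cong (D +_) sucE))) (sym (+-identityʳ _))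
            k-D+E : k (D + E) ≡ at q E
            k-D+E = trans (cong k (trans (cong (D +_) (sym (m+[n∸m]≡n 1≤E))) (+-suc D (E ∸ 1))))
              (trans (k≡ _ (s≤s (+-monoʳ-≤ D (s≤s⁻¹ (≤-trans (≤-reflexive (m+[n∸m]≡n 1≤E))
                  (≤-trans E≤D (≤-reflexive (sym suc-a≡D))))))))
                (trans (fork-right p q (λ _ → p≢q) (E ∸ 1)) (cong (at q) (m+[n∸m]≡n 1≤E))))

        -- The indices are chosen such that …, v₋₁, u₀, v₁, u₂, v₃, … and …, u₋₁, v₀, u₁, v₂, … are chains of repeats.
        module CrossEscape {k} (K : Cycle (D + D) k) (single : opp k 0 ≢ k 0) (cross : Cross k 0) where
          u₋₁ u₀ u₁ u₂ v₋₁ v₀ v₁ v₂ v₃ p : V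
          u₋₁ = opp k 1
          u₀ = k 0
          u₁ = k 1
          u₂ = opp k 0
          v₋₁ = opp k D
          v₀ = k (1 + D)
          v₁ = k D
          v₂ = opp k (1 + D)
          v₃ = other u₂ v₁
          p = prev (D + D) k 0

          ru₀ : Reps u₀ v₁ v₋₁
          ru₀ = reps-cyc K 0
          ru₁ : Reps u₁ v₀ v₂
          ru₁ = reps-cyc K 1
          rv₀ : Reps v₀ u₁ u₋₁
          rv₀ = reps-opp K 1
          rv₁ : Reps v₁ u₀ u₂
          rv₁ = reps-opp K 0
          ru₂ : Reps u₂ v₁ v₃
          ru₂ = R⇒Reps-sym (Reps⇒R (Reps-swap rv₁))

          u₀~u₁ : u₀ ~ u₁
          u₀~u₁ = cyc-edge K 0
          u₂~u₁ : u₂ ~ u₁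
          u₂~u₁ = proj₁ cross
          u₋₁~u₀ : u₋₁ ~ u₀
          u₋₁~u₀ = proj₂ cross
          v₁~v₀ : v₁ ~ v₀
          v₁~v₀ = cyc-edge K D
          v₋₁~v₀ : v₋₁ ~ v₀
          v₋₁~v₀ = proj₁ (Cross-shift K 0 cross)
          v₂~v₁ : v₂ ~ v₁
          v₂~v₁ = proj₂ (Cross-shift K 0 cross)

          u₀≢u₂ : u₀ ≢ u₂
          u₀≢u₂ e = single (sym e)
          v₁≢v₋₁ : v₁ ≢ v₋₁
          v₁≢v₋₁ e = u₀≢u₂ (Reps-unique (double-sym (subst (Reps u₀ v₁) (sym e) ru₀)) rv₁)
          v₁≢v₃ : v₁ ≢ v₃
          v₁≢v₃ e = u₀≢u₂ (sym (Reps-unique (double-sym (subst (Reps u₂ v₁) (sym e) ru₂)) (Reps-swap rv₁)))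
          u₁≢p : u₁ ≢ p
          u₁≢p = prev≢next K (≤-trans 1≤D (m≤m+n D D)) 0

          v₃~v₀⊎v₂ : v₃ ~ v₀ ⊎ v₃ ~ v₂
          v₃~v₀⊎v₂ = one-adjacent ru₁ (R⇒Reps-sym (Reps⇒R (Reps-swap ru₂))) (~-sym u₂~u₁)

          v₀→u₀ : Path v₀ u₀ E
          v₀→u₀ = castEnd (trans (cong k (trans (+-suc E D) (cong (_+ D) sucE))) (cyc-per K 0))
              (arc⁺ K (1 + D) E)

          v₋₁→u₀ : Path v₋₁ u₀ (suc E)
          v₋₁→u₀ = cons v₋₁~v₀ v₀→u₀ (λ _ e → k≢opp K D (sym e))

          first-v₋₁→u₀ : first (reverse v₋₁→u₀) ≡ p
          first-v₋₁→u₀ = trans (cong (glue 0 (λ _ → v₋₁) (at v₀→u₀)) (sym (m+[n∸m]≡n 1≤E))) (cong k index)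
            where
            index : E ∸ 1 + (1 + D) ≡ pred (D + D) + 0
            index = trans (+-suc (E ∸ 1) D) (trans (cong (_+ D) (m+[n∸m]≡n 1≤E))
              (trans (cong pred (cong (_+ D) sucE)) (sym (+-identityʳ _))))

          -- Going backwards along the cycle leads to `v₁` in `D` steps; leaving it at `v₀`, one
          -- step earlier, leads to `v₋₁`.
          via-p : ∀ {y} → R u₀ y → ∃ λ l → 1 ≤ l × l ≤ D × ∃ λ (π : Path u₀ y l) → first π ≡ p
          via-p Ru₀y = [ (λ { refl → D , 1≤D , ≤-refl , arc⁻′ , arc⁻′-first }) ,
              (λ { refl → suc E , s≤s z≤n , ≤-reflexive sucE , reverse v₋₁→u₀ , first-v₋₁→u₀ }) ]′
              (Reps-R ru₀ Ru₀y)
            where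
            arc⁻′ : Path u₀ v₁ D
            arc⁻′ = castEnd (cong k (+-identityʳ D)) (arc⁻ K 0 D D refl)
            arc⁻′-first : first arc⁻′ ≡ p
            arc⁻′-first = cong k (trans (cong (E +_) (+-identityʳ D)) (trans (cong pred (cong (_+ D) sucE))
                (sym (+-identityʳ _))))

          -- With the walk through `p` there would be three walks to `y`, so `y` would be a double
          -- repeat of `u₀`, against `v₁≢v₋₁`.
          two-paths-avoid-p : ∀ {y a b} → R u₀ y → (π : Path u₀ y a) (ρ : Path u₀ y b) → 1 ≤ a → a ≤ D → 1 ≤
              b → b ≤ D →
                              first π ≢ first ρ → first π ≢ p → first ρ ≢ p → ⊥
          two-paths-avoid-p {y} Ru₀y π ρ 1≤a a≤D 1≤b b≤D π≢ρ π≢p ρ≢p with via-p Ru₀y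
          ... | l , 1≤l , l≤D , σ , σ₁ = v₁≢v₋₁
              (v₁≡v₋₁ (three-paths⇒double π ρ σ 1≤a a≤D 1≤b b≤D 1≤l l≤D π≢ρ (λ e → π≢p (trans e σ₁))
              (λ e → ρ≢p (trans e σ₁))))
            where
            v₁≡v₋₁ : r₁ u₀ ≡ y × r₂ u₀ ≡ y → v₁ ≡ v₋₁
            v₁≡v₋₁ (e₁ , e₂) = [ (λ { (a , b) → trans (sym a) (trans e₁ (trans (sym e₂) b)) }) ,
                (λ { (a , b) → trans (sym b) (trans e₂ (trans (sym e₁) a)) }) ]′ ru₀

          -- If u₁ is a double repeat, then the third path from u₁ to v₀ passes through u₂ and v₋₁.
          double⇒v₋₁≢v₃ : v₀ ≡ v₂ → v₋₁ ≢ v₃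
          double⇒v₋₁≢v₃ v₀≡v₂ v₋₁≡v₃ = third (double⇒third-path (proj₁ r≡) (proj₂ r≡) u₀ (k 2))
            where
            r≡ : r₁ u₁ ≡ v₀ × r₂ u₁ ≡ v₀
            r≡ = [ (λ r → r) , (λ r → r) ]′ (subst (Reps u₁ v₀) (sym v₀≡v₂) ru₁)
            D+1 : k (D + 1) ≡ v₀
            D+1 = cong k (+-comm D 1)
            backward : Path u₁ v₀ D
            backward = castEnd D+1 (cycle-back K 0)
            forward : Path u₁ v₀ (suc E)
            forward = castEnd (trans (cong (λ l → k (l + 1)) sucE) D+1) (arc⁺ K 1 (suc E))
            third : (∃ λ a → a < D × ∃ λ (σ : Path u₁ v₀ (suc a)) → first σ ≢ u₀ × first σ ≢ k 2) → ⊥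
            -- Between its end steps `σ` joins `u₂` to `v₋₁` in `D - 2` steps, too few if `v₋₁` is
            -- the repeat `v₃` of `u₂`.
            third (a , a<D , σ , σ≢u₀ , σ≢k2) = R-far u₂-R middle 1≤E∸1
                (≤-reflexive (trans (cong suc (m+[n∸m]≡n 1≤E)) sucE))
              where
              A₁ : Antipodes backward σ
              A₁ = antipodes backward σ a<D (λ e → σ≢u₀ (trans (sym e) (first-cycle-back K 0)))
              a≡E : a ≡ E
              a≡E = cong pred (Antipodes.length≡D A₁)
              σ′ : Path u₁ v₀ D
              σ′ .at = at σ
              σ′ .isPath = subst (IsPath (at σ)) (Antipodes.length≡D A₁) (isPath σ)
              σ′ .start = start σ
              σ′ .end = trans (cong (at σ) (sym (Antipodes.length≡D A₁))) (end σ)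
              A₂ : Antipodes σ′ forward
              A₂ = antipodes σ′ forward (≤-reflexive sucE) σ≢k2
              forward-E : at forward E ≡ v₁
              forward-E = cong k (trans (+-comm E 1) sucE)
              σ₁≡u₂ : first σ ≡ u₂
              σ₁≡u₂ = [ (λ e → ⊥-elim (σ≢u₀ e)) , (λ e → e) ]′
                  (Reps-R rv₁ (R-sym (subst (R (first σ)) forward-E (Antipodes.antipodal A₂))))
              σ-E≡v₋₁ : at σ E ≡ v₋₁
              σ-E≡v₋₁ = [ (λ e → ⊥-elim (Antipodes.last-steps A₂ (trans e (sym forward-E)))) , (λ e → e) ]′
                (Reps-R ru₀ (subst (λ v → R v (at σ E)) (first-cycle-back K 0) (Antipodes.antipodal A₁)))
              u₂-R : R (first σ) (at σ E)
              u₂-R = subst₂ R (sym σ₁≡u₂) (sym (trans σ-E≡v₋₁ v₋₁≡v₃)) (Reps⇒R (Reps-swap ru₂))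
              1≤E∸1 : 1 ≤ E ∸ 1
              1≤E∸1 = m<n⇒0<n∸m (s≤s⁻¹ (subst (3 ≤_) (sym sucE) (≤-trans (s≤s (s≤s (s≤s z≤n))) 4≤D)))
              middle : Path (first σ) (at σ E) (E ∸ 1)
              middle = castEnd (cong (at σ) (m+[n∸m]≡n 1≤E))
                  (take (tail σ) (E ∸ 1) (≤-trans (m∸n≤m E 1) (≤-reflexive (sym a≡E))))

          module _ {w} (u₀~w : u₀ ~ w) (w≢u₁ : w ≢ u₁) (w≢u₋₁ : w ≢ u₋₁) (w≢p : w ≢ p) where

            w~u₀ : w ~ u₀
            w~u₀ = ~-sym u₀~w

            w≁u₂ : w ≁ u₂
            w≁u₂ w~u₂ = w≢u₁ (common-nbr u₀≢u₂ u₀~w w~u₂ u₀~u₁ (~-sym u₂~u₁))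

            ¬Rwv₀ : ¬ R w v₀
            ¬Rwv₀ r = [ w≢u₁ , w≢u₋₁ ]′ (Reps-R rv₀ (R-sym r))

            module _ (Par : Parallel v₁ u₂ w) where
              open Parallel Par
              open ParallelProperties rv₁ w~u₀ w≁u₂ Par

              w₁≢v₀ : w₁ ≢ v₀
              w₁≢v₀ e = ¬Rwv₀ (subst (R w) e (Reps⇒R reps-w))

              w₂≢u₁ : w₂ ≢ u₁
              w₂≢u₁ e = [ w₁≢v₀ , w₁≡v₂-absurd ]′ (Reps-R ru₁ (R-sym (Reps⇒R (Reps-swap rw₁))))
                where
                rw₁ : Reps w₁ w u₁
                rw₁ = subst (Reps w₁ w) e reps-w₁
                w₁≡v₂-absurd : w₁ ≢ v₂
                -- `u₀` is adjacent to both repeats `u₁` and `w` of `v₂`, so `v₂` is, like `v₀`, a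
                -- common neighbour of `v₁` and `v₋₁`.
                w₁≡v₂-absurd e′ = w₁≢v₀ (trans e′ (sym (common-nbr v₁≢v₋₁ v₁~v₀ (~-sym v₋₁~v₀) (~-sym v₂~v₁)
                  (proj₂ (both-adjacent ru₀ (subst (λ v → Reps v u₁ w) e′ (Reps-swap rw₁)) u₀~u₁ u₀~w)))))

              w₋₁≢v₀ : w₋₁ ≢ v₀
              w₋₁≢v₀ e = v₁≁w₋₁ (subst (v₁ ~_) (sym e) v₁~v₀)

              w₋₁≢v₂ : w₋₁ ≢ v₂
              w₋₁≢v₂ e = v₁≁w₋₁ (subst (v₁ ~_) (sym e) (~-sym v₂~v₁))

              -- Otherwise `w₋₁` is adjacent to both `v₋₁` and `v₃`. If `v₀` is `v₂`, then `v₀` is a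
              -- second common neighbour of these two. If not, adjacency of `v₃` to `v₀` would force
              -- `u₁` to be `u₋₁` and make `v₀` a double repeat, and adjacency to `v₂` closes the
              -- hexagon `w₋₁`, `v₋₁`, `v₀`, `v₁`, `v₂`, `v₃`.
              ¬R-w₂-w₋₁ : ¬ R w₂ w₋₁
              ¬R-w₂-w₋₁ r = byCase (v₀ Fin.≟ v₂) v₃~v₀⊎v₂
                where
                v₃~v₀-absurd : v₋₁ ≢ v₃ → v₃ ~ v₀ → ⊥
                v₃~v₀-absurd v₋₁≢v₃ v₃~v₀ = w₋₁≢v₀ (common-nbr v₋₁≢v₃ (~-sym (w₋₁~v₋₁ ru₀)) (w₋₁~v₃ ru₂ r)
                    v₋₁~v₀ (~-sym v₃~v₀))
                byCase : Dec (v₀ ≡ v₂) → v₃ ~ v₀ ⊎ v₃ ~ v₂ → ⊥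
                byCase (yes e) (inj₁ v₃~v₀) = v₃~v₀-absurd (double⇒v₋₁≢v₃ e) v₃~v₀
                byCase (yes e) (inj₂ v₃~v₂) = v₃~v₀-absurd (double⇒v₋₁≢v₃ e) (subst (v₃ ~_) (sym e) v₃~v₂)
                byCase (no v₀≢v₂) (inj₁ v₃~v₀) = v₀≢v₂
                    (Reps-unique (double-sym (subst (Reps v₀ u₁) (sym u₁≡u₋₁) rv₀)) ru₁)
                  where
                  u₁≡u₋₁ : u₁ ≡ u₋₁
                  u₁≡u₋₁ = common-nbr u₀≢u₂ u₀~u₁ (~-sym u₂~u₁) (~-sym u₋₁~u₀)
                      (~-sym (proj₂ (both-adjacent rv₀ ru₂ (~-sym v₁~v₀) (~-sym v₃~v₀))))
                byCase (no v₀≢v₂) (inj₂ v₃~v₂) = no-hexagon (w₋₁~v₋₁ ru₀) v₋₁~v₀ (~-sym v₁~v₀) (~-sym v₂~v₁)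
                    (~-sym v₃~v₂) (~-sym (w₋₁~v₃ ru₂ r))
                  w₋₁≢v₀ (v₁≢v₋₁ ∘ sym) v₀≢v₂ v₁≢v₃ (w₋₁≢v₂ ∘ sym)

              cross-detour : Detour w w₁ w₂
              cross-detour = pick (R⇒even-Cycle (Reps⇒R reps-w))
                where
                pick : (∃ λ k′ → Cycle (D + D) k′ × k′ 0 ≡ w × k′ D ≡ w₁) → Detour w w₁ w₂
                pick (k′ , K′ , e₀ , e-D) = detour-w K′ e₀ e-D ¬R-w₂-w₋₁

              -- The antipode `y` of `u₀` on `k′` is adjacent to `w₁`. If it is `v₁`, the walk back
              -- through `w` and the one along `k` both avoid `p`. If it is `v₋₁`, then `w₁` is,
              -- like `v₀`, a common neighbour of `v₁` and `v₋₁`.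
              no-u₀-on-detour : ∀ {k′} → Cycle (D + D) k′ → k′ 0 ≡ w → k′ D ≡ w₁ → k′ 1 ≢ u₀
              no-u₀-on-detour {k′} K′ e₀ e-D e₁ = [ to-v₁ , to-v₋₁ ]′ (Reps-R ru₀ Ru₀y)
                where
                y = k′ (D + 1)
                Ru₀y : R u₀ y
                Ru₀y = subst (λ v → R v y) e₁ (cycle-R K′ refl 1≤D ≤-refl 1≤D ≤-refl 1)
                w₁~y : w₁ ~ y
                w₁~y = subst₂ _~_ e-D (cong k′ (+-comm 1 D)) (cyc-edge K′ D)
                back : Path u₀ y D
                back = castStart e₁ (cycle-back K′ 0)
                back₁ : first back ≡ w
                back₁ = trans (first-cycle-back K′ 0) e₀
                forward : Path u₀ v₁ D
                forward = castEnd (cong k (+-identityʳ D)) (arc⁺ K 0 D)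
                to-v₁ : y ≢ v₁
                to-v₁ e = two-paths-avoid-p Ru₀y back (castEnd (sym e) forward) 1≤D ≤-refl 1≤D ≤-refl
                  (λ e′ → w≢u₁ (trans (sym back₁) e′)) (λ e′ → w≢p (trans (sym back₁) e′)) u₁≢p
                to-v₋₁ : y ≢ v₋₁
                to-v₋₁ e = w₁≢v₀ (common-nbr v₁≢v₋₁ v₁~w₁ (subst (w₁ ~_) e w₁~y) v₁~v₀ (~-sym v₋₁~v₀))

              q : Path w w₂ 4
              q = cons w~u₀ (cons u₀~u₁ (cons (~-sym u₂~u₁) (cons u₂~w₂ empty (λ ())) (λ _ → w₂≢u₁ ∘ sym))
                  (λ _ → u₀≢u₂)) (λ _ → w≢u₁)

              -- Together with `q` the path closes to length 2h + 6, which is at most 2D + 1 and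
              -- even. The resulting cycle of length 2D passes `w`, `u₀`, `u₁`, and its two arcs
              -- from `u₀` avoid `p`.
              closing : ∀ h → suc (h + h) ≤ D → (π : Path w w₂ (2 + (h + h))) → first π ≢ u₀ → ⊥
              closing h h< π π≢u₀ = onCycle (closed⇒even-Cycle (s≤s z≤n) len≤ l)
                where
                a = 2 + (h + h)
                len = suc (a + 3)
                l : Path w₂ w₂ len
                l = fork π q (λ _ → π≢u₀)
                open +-*-Solver
                len≤ : len ≤ D + D
                len≤ = ≮⇒≥ (λ lt → len≢ (≤-antisym len≤suc lt))
                  where
                  len≤suc : len ≤ suc (D + D)
                  len≤suc = ≤-trans (≤-reflexive (solve 1 (λ h → con 1 :+ (con 2 :+ (h :+ h) :+ con 3) :=
                      con 1 :+ (con 1 :+ (h :+ h) :+ con 4)) refl h)) (s≤s (+-mono-≤ h< 4≤D))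
                  len≢ : len ≢ suc (D + D)
                  len≢ e = double≢odd (h + 3) D (trans
                      (solve 1 (λ h → h :+ con 3 :+ (h :+ con 3) := con 1 :+ (con 2 :+ (h :+ h) :+ con 3))
                      refl h) e)
                onCycle : len ≡ D + D × (∃ λ k′ → Cycle len k′ × (∀ i → i ≤ len → k′ i ≡ at l i)) → ⊥
                onCycle (len≡ , k′ , K , k′≡) = two-paths-avoid-p (subst (λ v → R v (k′ (D + suc a))) at-u₀
                    (cycle-R K′ refl 1≤D ≤-refl 1≤D ≤-refl (suc a)))
                    (castStart at-u₀ (arc⁺ K′ (suc a) D)) (castStart at-u₀ (cycle-back K′ a)) 1≤D ≤-refl 1≤D
                        ≤-refl
                    (λ e → w≢u₁ (trans (sym back₁) (trans (sym e) at-u₁)))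
                    (λ e → u₁≢p (trans (sym at-u₁) e))
                    (λ e → w≢p (trans (sym back₁) e))
                  where
                  K′ : Cycle (D + D) k′
                  K′ = subst (λ c → Cycle c k′) len≡ K
                  at-w : k′ a ≡ w
                  at-w = trans (k′≡ a (≤-trans (m≤m+n a 3) (n≤1+n _)))
                      (trans (fork-left π q (λ _ → π≢u₀) a ≤-refl) (trans (cong (at π) (n∸n≡0 a)) (start π)))
                  at-u₀ : k′ (suc a) ≡ u₀
                  at-u₀ = trans (cong k′ (cong suc (sym (+-identityʳ a))))
                      (trans (k′≡ (suc (a + 0)) (s≤s (+-monoʳ-≤ a z≤n))) (fork-right π q (λ _ → π≢u₀) 0))
                  at-u₁ : k′ (2 + a) ≡ u₁
                  at-u₁ = trans (cong k′ (cong suc (+-comm 1 a)))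
                      (trans (k′≡ (suc (a + 1)) (s≤s (+-monoʳ-≤ a (s≤s z≤n)))) (fork-right π q (λ _ → π≢u₀) 1))
                  back₁ : first (castStart at-u₀ (cycle-back K′ a)) ≡ w
                  back₁ = trans (first-cycle-back K′ a) at-w

              escape-absurd : Detour w w₁ w₂ → ⊥
              escape-absurd Δ = closing half half< path (λ e → no-u₀-on-detour isCycle cyc-0 cyc-D
                  (trans (sym path-1) e))
                where open Detour Δ

        no-Cross-at-0 : ∀ {k} → Cycle (D + D) k → opp k 0 ≢ k 0 → ¬ Cross k 0
        no-Cross-at-0 {k} K single cross with fresh-nbr (k 0) (k 1) (opp k 1) (prev (D + D) k 0)
        ... | w , u₀~w , w≢u₁ , w≢u₋₁ , w≢p = escape-absurd u₀~w w≢u₁ w≢u₋₁ w≢p Par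
            (cross-detour u₀~w w≢u₁ w≢u₋₁ w≢p Par)
          where
          open CrossEscape K single cross
          Par = parallel rv₁ (~-sym u₀~w) (w≁u₂ u₀~w w≢u₁ w≢u₋₁ w≢p)

        shift-Cycle : ∀ {c k} → Cycle c k → ∀ i → Cycle c (λ j → k (j + i))
        shift-Cycle {c} {k} K i = record
          { cyc-edge = λ j → cyc-edge K (j + i) ; cyc-nb = λ j → cyc-nb K (j + i)
          ; cyc-per = λ j → trans (cong k
              (trans (+-assoc j c i) (trans (cong (j +_) (+-comm c i)) (sym (+-assoc j i c)))))
              (cyc-per K (j + i)) }

        -- The cycle is shifted to its first crossing, up to which singleness propagates.
        no-Cross-on-Cycle : ∀ {k} → Cycle (D + D) k → opp k 0 ≢ k 0 → ∀ i → ¬ Cross k i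
        no-Cross-on-Cycle {k} K single₀ i Xi with least (Cross? k) i Xi
        ... | h , _ , Xh , minimal = no-Cross-at-0 (shift-Cycle K h)
            (λ e → single h ≤-refl (trans (sym (opp≡ 0)) e))
              (subst (_~ k (suc h)) (sym (opp≡ 0)) (proj₁ Xh) , subst (_~ k h) (sym (opp≡ 1)) (proj₂ Xh))
          where
          single : ∀ j → j ≤ h → opp k j ≢ k j
          single zero _ = single₀
          single (suc j) j<h = Single-suc K j (minimal j j<h)
          opp≡ : ∀ j → opp (λ j → k (j + h)) j ≡ opp k (j + h)
          opp≡ j = cong (λ l → other (k l) (k (j + h)))
              (trans (+-assoc j D h) (trans (cong (j +_) (+-comm D h)) (sym (+-assoc j h D))))

        -- On a cycle of length 2D with `x` and `a` antipodal, the two vertices are `opp k 0` and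
        -- `opp k D`.
        R-square : ∀ {x a b} → Reps x a b → a ≢ b → R (other a x) b
        R-square {x} {a} {b} rx a≢b with R⇒even-Cycle (Reps⇒R rx)
        ... | k , K , refl , refl = subst (R (opp k 0)) (Reps-unique (reps-cyc K 0) rx)
            (no-Cross⇒R K single (no-Cross-on-Cycle K single))
          where
          single : opp k 0 ≢ k 0
          single e = a≢b (Reps-unique (double-sym (subst (Reps (k D) (k 0)) e (reps-opp K 0))) rx)

        -- The fixed-point-free involution: partners on double edges, opposite corners on 4-cycles.

        opposite : V → V
        opposite x with r₁ x Fin.≟ r₂ x
        ... | yes _ = r₁ x
        ... | no _ = other (r₁ x) x

        opposite-double : ∀ {x a} → Reps x a a → opposite x ≡ a
        opposite-double {x} rx with r₁ x Fin.≟ r₂ x | rx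
        ... | yes _ | inj₁ (e , _) = e
        ... | yes _ | inj₂ (e , _) = e
        ... | no ≢ | inj₁ (e , e′) = ⊥-elim (≢ (trans e (sym e′)))
        ... | no ≢ | inj₂ (e , e′) = ⊥-elim (≢ (trans e (sym e′)))

        -- Both repeats lead to the same `t`, so it does not matter which of them is `r₁ x`.
        opposite-single : ∀ {x a b t} → Reps x a b → a ≢ b → Reps a x t → Reps b x t → opposite x ≡ t
        opposite-single {x} rx a≢b ra rb with r₁ x Fin.≟ r₂ x | rx
        ... | yes e | inj₁ (refl , refl) = ⊥-elim (a≢b e)
        ... | yes e | inj₂ (refl , refl) = ⊥-elim (a≢b (sym e))
        ... | no _ | inj₁ (refl , refl) = Reps-unique (other-Reps (Reps⇒R ra)) ra
        ... | no _ | inj₂ (refl , refl) = Reps-unique (other-Reps (Reps⇒R rb)) rb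

        record Square (x : V) : Set where
          field
            {a b t} : V
            rx : Reps x a b
            rt : Reps t a b
            ra : Reps a x t
            rb : Reps b x t
            a≢b : a ≢ b
            t≢x : t ≢ x

        square : ∀ {x a b} → Reps x a b → a ≢ b → Square x
        square {x} {a} {b} rx a≢b = record
          { rx = rx ; rt = two-R⇒Reps (R-sym (Reps⇒R (Reps-swap ra))) Rtb a≢b ; ra = ra
          ; rb = two-R⇒Reps (R-sym (Reps⇒R (Reps-swap rx))) (R-sym Rtb) (t≢x ∘ sym) ; a≢b = a≢b ; t≢x = t≢x }
          where
          t = other a x
          ra : Reps a x t
          ra = R⇒Reps-sym (Reps⇒R rx)
          Rtb : R t b
          Rtb = R-square rx a≢b
          t≢x : t ≢ x
          t≢x e = a≢b (Reps-unique (double-sym (subst (Reps a x) e ra)) rx)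

        double-or-square : ∀ x → (∃ λ a → Reps x a a) ⊎ Square x
        double-or-square x with r₁ x Fin.≟ r₂ x
        ... | yes e = inj₁ (r₁ x , inj₁ (refl , sym e))
        ... | no r₁≢r₂ = inj₂ (square (inj₁ (refl , refl)) r₁≢r₂)

        opposite≢ : ∀ x → opposite x ≢ x
        opposite≢ x e with double-or-square x
        ... | inj₁ (a , rx) = R⇒≢ (Reps⇒R rx) (trans (sym e) (opposite-double rx))
        ... | inj₂ s = t≢x (trans (sym (opposite-single rx a≢b ra rb)) e)
          where open Square s

        opposite-involutive : ∀ x → opposite (opposite x) ≡ x
        opposite-involutive x with double-or-square x
        ... | inj₁ (a , rx) = trans (cong opposite (opposite-double rx)) (opposite-double (double-sym rx))
        ... | inj₂ s = trans (cong opposite (opposite-single rx a≢b ra rb))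
            (opposite-single rt a≢b (Reps-swap ra) (Reps-swap rb))
          where open Square s

        order-even : ∃ λ h → n ≡ h + h
        order-even = involution-even opposite opposite≢ opposite-involutive

  -- Regularity and the repeat matrix from the order.

  module DefectTwo {q D : ℕ} (3≤q : 3 ≤ q) (4≤D : 4 ≤ D)
    (deg≤ : ∀ x → sum (A x) ≤ suc q) (C-pos : ∀ x y → 1 ≤ C D x y)
    (order : n + 2 ≡ 1 + suc q * geomSum q D) where

    3≤geomSum : 3 ≤ geomSum q D
    3≤geomSum = ≤-trans (≤-trans 3≤q (≤-trans (≤-reflexive (sym (*-identityʳ q))) (n≤1+n _))) (mono D 2≤D)
      where
      2≤D : 2 ≤ D
      2≤D = ≤-trans (s≤s (s≤s z≤n)) 4≤D
      mono : ∀ m → 2 ≤ m → geomSum q 2 ≤ geomSum q m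
      mono (suc m) 2≤m with m≤n⇒m<n∨m≡n 2≤m
      ... | inj₁ lt = ≤-trans (mono m (s≤s⁻¹ lt)) (m≤m+n _ _)
      ... | inj₂ refl = ≤-refl

    order≤row : ∀ x → n ≤ sum (C D x)
    order≤row x = ≤-trans (≤-reflexive (sym (sum-one n))) (sum-mono (C-pos x))

    -- A smaller degree at `x` would lower the number of walks from `x` by at least `geomSum q D`,
    -- which is at least 3, while only 2 can be spared.
    deg≡ : ∀ x → sum (A x) ≡ suc q
    deg≡ x = ≤-antisym (deg≤ x) (≮⇒≥ (λ lt → <⇒≱ 3≤geomSum (+-cancelʳ-≤ (1 + q * geomSum q D) _ _ (begin
      geomSum q D + (1 + q * geomSum q D)   ≡⟨ +-suc (geomSum q D) _ ⟩
      1 + suc q * geomSum q D               ≡⟨ order ⟨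
      n + 2                                 ≡⟨ +-comm n 2 ⟩
      2 + n                                 ≤⟨ +-monoʳ-≤ 2 (order≤row x) ⟩
      2 + sum (C D x)                       ≤⟨ +-monoʳ-≤ 2 (rowC-≤ deg≤ D x) ⟩
      2 + (1 + sum (A x) * geomSum q D)     ≤⟨ +-monoʳ-≤ 3 (*-monoˡ-≤ (geomSum q D) (s≤s⁻¹ lt)) ⟩
      2 + (1 + q * geomSum q D)             ∎))))
      where open ≤-Reasoning

    excess : V → V → ℕ
    excess x y = C D x y ∸ 1

    C≡1+excess : ∀ x y → C D x y ≡ 1 + excess x y
    C≡1+excess x y = sym (m+[n∸m]≡n (C-pos x y))

    Σexcess≡2 : ∀ x → sum (excess x) ≡ 2
    Σexcess≡2 x = +-cancelˡ-≡ n _ _ (begin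
      n + sum (excess x)                      ≡⟨ cong (_+ sum (excess x)) (sym (sum-one n)) ⟩
      sum {n} (λ _ → 1) + sum (excess x)      ≡⟨ sym (∑-distrib-+ (λ _ → 1) (excess x)) ⟩
      sum (λ y → 1 + excess x y)              ≡⟨ sum-cong-≗ (λ y → sym (C≡1+excess x y)) ⟩
      sum (C D x)                             ≡⟨ rowC-≡ deg≡ D x ⟩
      1 + suc q * geomSum q D                 ≡⟨ order ⟨
      n + 2                                   ∎)
      where open ≡-Reasoning

    two-units : ∀ x → ∃₂ λ a b → ∀ y → excess x y ≡ δ y a + δ y b
    two-units x with sum-unit (excess x) (Σexcess≡2 x)
    ... | a , g , f≡ , Σg≡1 with sum-unit g Σg≡1
    ... | b , h , g≡ , Σh≡0 = a , b , λ y →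
      trans (f≡ y) (cong (δ y a +_) (trans (g≡ y) (trans (cong (δ y b +_) (sum-≡0 h Σh≡0 y)) (+-identityʳ _))))

    r₁ r₂ : V → V
    r₁ x = proj₁ (two-units x)
    r₂ x = proj₁ (proj₂ (two-units x))

    C≡ : ∀ x y → C D x y ≡ suc (δ y (r₁ x) + δ y (r₂ x))
    C≡ x y = trans (C≡1+excess x y) (cong suc (proj₂ (proj₂ (two-units x)) y))

    δ-symm : ∀ x y → δ y (r₁ x) + δ y (r₂ x) ≡ δ x (r₁ y) + δ x (r₂ y)
    δ-symm x y = suc-injective (trans (sym (C≡ x y)) (trans (proj₁ (C-sym deg≡ D) x y) (C≡ y x)))

    -- The matrix `C D` is the all-ones matrix plus the repeat matrix. By regularity the adjacency
    -- matrix times the all-ones matrix has constant entries `suc q`, which cancel.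
    A-comm : ∀ x z → A z (r₁ x) + A z (r₂ x) ≡ A x (r₁ z) + A x (r₂ z)
    A-comm x z = sym (+-cancelˡ-≡ (suc q) _ _
        (trans (sym (AC≡ x z)) (trans (proj₂ (C-sym deg≡ D) x z) (AC≡ z x))))
      where
      open ≡-Reasoning
      open +-*-Solver
      sum-A-δ : ∀ x v → sum (λ u → A x u * δ u v) ≡ A x v
      sum-A-δ x v = trans (sum-cong-≗ (λ u → trans (*-comm (A x u) _) (cong (_* A x u) (δ-sym u v))))
          (sum-δ v (A x))
      AC≡ : ∀ x z → AN (C D) x z ≡ suc q + (A x (r₁ z) + A x (r₂ z))
      AC≡ x z = begin
        sum (λ u → A x u * C D u z)
          ≡⟨ sum-cong-≗ (λ u → cong (A x u *_) (trans (proj₁ (C-sym deg≡ D) u z) (C≡ z u))) ⟩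
        sum (λ u → A x u * (1 + (δ u (r₁ z) + δ u (r₂ z))))
          ≡⟨ sum-cong-≗ (λ u → solve 3 (λ a b c → a :* (con 1 :+ (b :+ c)) := a :+ (a :* b :+ a :* c)) refl
              (A x u) (δ u (r₁ z)) (δ u (r₂ z))) ⟩
        sum (λ u → A x u + (A x u * δ u (r₁ z) + A x u * δ u (r₂ z)))
          ≡⟨ ∑-distrib-+ (A x) (λ u → A x u * δ u (r₁ z) + A x u * δ u (r₂ z)) ⟩
        sum (A x) + sum (λ u → A x u * δ u (r₁ z) + A x u * δ u (r₂ z))
          ≡⟨ cong₂ _+_ (deg≡ x) (∑-distrib-+ (λ u → A x u * δ u (r₁ z)) (λ u → A x u * δ u (r₂ z))) ⟩
        suc q + (sum (λ u → A x u * δ u (r₁ z)) + sum (λ u → A x u * δ u (r₂ z)))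
          ≡⟨ cong (suc q +_) (cong₂ _+_ (sum-A-δ x (r₁ z)) (sum-A-δ x (r₂ z))) ⟩
        suc q + (A x (r₁ z) + A x (r₂ z)) ∎

    fresh-nbr : ∀ u a b c → ∃ λ w → u ~ w × w ≢ a × w ≢ b × w ≢ c
    fresh-nbr u a b c with sum-pick (a ∷ b ∷ c ∷ []) (A u) (≤-<-trans
        (+-mono-≤ (A-≤1 u a) (+-mono-≤ (A-≤1 u b) (+-mono-≤ (A-≤1 u c) z≤n)))
            (≤-trans (s≤s 3≤q) (≤-reflexive (sym (deg≡ u)))))
    ... | w , w∉ , 1≤A = w , A-pos 1≤A , (λ e → w∉ (here e)) , (λ e → w∉ (there (here e))) ,
        (λ e → w∉ (there (there (here e))))

    order-even : ∃ λ h → n ≡ h + h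
    order-even = Repeats.Commuting.Exclusion.order-even D 4≤D r₁ r₂ C≡ δ-symm A-comm fresh-nbr

theorem5p8 : (d D : ℕ) → 4 ≤ d → 2 ∣ d → 4 ≤ D → ¬ DDEGraph d D 2
theorem5p8 (suc q) D 4≤d (divides j d≡) 4≤D record { order = n ; graph = G ; maxDeg = deg≤ , _ ; diam = diam
    , _ ; orderEq = order } =
  even-order-absurd (DefectTwo.order-even (s≤s⁻¹ 4≤d) 4≤D
    (λ x → ≤-trans (≤-reflexive (sym (degree≡ΣA x))) (deg≤ x)) reach order)
  where
  open Graph G
  reach : ∀ x y → 1 ≤ C D x y
  reach x y with diam x y
  ... | l , l≤D , ω with Walk⇒Path ω
  ... | k , k≤l , π = Path⇒C-pos π (≤-trans k≤l l≤D)
  even-order-absurd : (∃ λ h → n ≡ h + h) → ⊥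
  even-order-absurd (h , n≡) = double≢odd (h + 1) (j * geomSum q D) (begin
    h + 1 + (h + 1)                             ≡⟨ solve 1 (λ h → h :+ con 1 :+ (h :+ con 1) := h :+ h :+
        con 2) refl h ⟩
    h + h + 2                                   ≡⟨ cong (_+ 2) n≡ ⟨
    n + 2                                       ≡⟨ order ⟩
    1 + suc q * geomSum q D                     ≡⟨ cong (λ d → 1 + d * geomSum q D) d≡ ⟩
    1 + j * 2 * geomSum q D                     ≡⟨ cong suc
        (solve 2 (λ j s → j :* con 2 :* s := j :* s :+ j :* s) refl j (geomSum q D)) ⟩
    1 + (j * geomSum q D + j * geomSum q D)     ∎)
    where
    open ≡-Reasoning
    open +-*-Solver
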